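{- Let $n\ge5$ be an odd integer and let $$L=\begin{bmatrix}\frac{n-1}{2} & -\frac12\mathbf{e}' & \mathbf{0}'\\ -\frac12\mathbf{e} & A & B\\ \mathbf{0} & B & I_{n-1}\end{bmatrix},$$ where $A=\mathrm{Circ}(\mathbf{x}')$ and $B=\mathrm{Circ}(\mathbf{y}')$ are the circulant matrices of order $n-1$ defined in the context. Then $L$ is a positive semidefinite matrix.
   Context: A prime denotes transpose; $\mathbf{e},\mathbf{0}\in\mathbb{R}^{n-1}$ are the all-ones and zero column vectors; $I_{n-1}$ is the identity matrix of order $n-1$. A real symmetric matrix $M$ is positive semidefinite if $\mathbf{z}'M\mathbf{z}\ge0$ for all real $\mathbf{z}$. For $\mathbf{a}=(a_1,\dots,a_N)'\in\mathbb{R}^N$, $\mathrm{Circ}(\mathbf{a}')$ is the $N\times N$ circulant matrix with first row $(a_1,a_2,\dots,a_N)$, each subsequent row being the previous row cyclically shifted one place to the right. Vectors $\mathbf{x},\mathbf{y}$ (for odd $n\ge5$): put $m=\frac{n-1}{2}$ and, for $1\le k\le m$, $\alpha_k=(-1)^{k+1}\left[2m^2-6(m-k)^2+7\right]$. Then $$\mathbf{x}=\frac{1}{6(n-1)}(n^2+4n-12,\alpha_1,\alpha_2,\dots,\alpha_{m-1},\alpha_m,\alpha_{m-1},\dots,\alpha_2,\alpha_1)'\in\mathbb{R}^{n-1},$$ $$\mathbf{y}=\frac{1}{n-1}(2-n,-1,1,-1,1,\dots,-1,1,-1)'\in\mathbb{R}^{n-1}.$$ (With these vectors $A$ and $B$,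 hence $L$, are symmetric.) -}

module Defs where

open import Algebra.Bundles using (RawMonoid)
import Algebra.Definitions.RawMonoid as RawMonoidDefs
open import Data.Bool.Base using (if_then_else_)
open import Data.Fin.Base using (Fin; toℕ)
import Data.Fin.Properties as Fin
open import Data.Integer.Base as ℤ using (ℤ; +_; -1ℤ)
open import Data.Nat.Base as ℕ using (ℕ; zero; suc; _∸_; _≤ᵇ_; _⊔_)
open import Data.Nat.DivMod using (_mod_)
import Data.Nat.Properties as ℕ
open import Data.Product.Base using (_×_; _,_; ∃-syntax)
open import Data.Rational.Base as ℚ
  using (ℚ; 0ℚ; 1ℚ; ½; _+_; _*_; -_; _-_; ∣_∣; _<_; _≤_; _/_; 1/_; Positive; positive)
open import Data.Rational.Properties
  using ( +-inverseʳ; *-inverseʳ; +-mono-<; +-monoʳ-≤; +-monoˡ-≤; *-monoʳ-≤-nonNeg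
        ; *-monoʳ-<-pos; pos⇒nonZero; 1/pos⇒pos; pos*pos⇒pos; positive⁻¹; <⇒≤
        ; 0≤∣p∣; ∣p+q∣≤∣p∣+∣q∣; ∣p*q∣≡∣p∣*∣q∣; module ≤-Reasoning)
open import Data.Rational.Solver using (module +-*-Solver)
open import Data.Vec.Functional using (Vector; _++_)
open import Relation.Binary.PropositionalEquality using (_≡_; refl; sym; cong; subst)
open import Relation.Nullary.Decidable.Core using (does)

------------------------------------------------------------------------
-- Real numbers as Cauchy sequences of rationals, with setoid equality.

Cauchy : (ℕ → ℚ) → Set
Cauchy x = ∀ ε → 0ℚ < ε →
  ∃[ N ] (∀ i j → N ℕ.≤ i → N ℕ.≤ j → ∣ x i - x j ∣ < ε)

record ℝ : Set where
  constructor _,ᶜ_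
  field
    seq    : ℕ → ℚ
    cauchy : Cauchy seq

open ℝ public

infix 4 _≃ᵣ_ _≤ᵣ_

_≃ᵣ_ : ℝ → ℝ → Set
x ≃ᵣ y = ∀ ε → 0ℚ < ε →
  ∃[ N ] (∀ k → N ℕ.≤ k → ∣ seq x k - seq y k ∣ < ε)

_≤ᵣ_ : ℝ → ℝ → Set
x ≤ᵣ y = ∀ ε → 0ℚ < ε →
  ∃[ N ] (∀ k → N ℕ.≤ k → seq x k < seq y k + ε)

fromℚ : ℚ → ℝ
fromℚ q = (λ _ → q) ,ᶜ λ ε 0<ε →
  0 , λ _ _ _ _ → subst (λ t → ∣ t ∣ < ε) (sym (+-inverseʳ q)) 0<ε

0ᵣ : ℝ
0ᵣ = fromℚ 0ℚ

private
  half-pos : ∀ {ε} → 0ℚ < ε → 0ℚ < ½ * ε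
  half-pos {ε} 0<ε = positive⁻¹ (½ * ε) {{pos*pos⇒pos ½ ε {{positive 0<ε}}}}

  halves : ∀ ε → ½ * ε + ½ * ε ≡ ε
  halves = solve 1 (λ e → con ½ :* e :+ con ½ :* e := e) refl
    where open +-*-Solver

  +-cauchy : ∀ x y → Cauchy x → Cauchy y → Cauchy (λ k → x k + y k)
  +-cauchy x y cx cy ε 0<ε
    with cx (½ * ε) (half-pos 0<ε) | cy (½ * ε) (half-pos 0<ε)
  ... | M , hx | N , hy = M ⊔ N , λ i j p q → begin-strict
    ∣ (x i + y i) - (x j + y j) ∣      ≡⟨ cong ∣_∣ (regroup (x i) (y i) (x j) (y j)) ⟩
    ∣ (x i - x j) + (y i - y j) ∣      ≤⟨ ∣p+q∣≤∣p∣+∣q∣ (x i - x j) (y i - y j) ⟩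
    ∣ x i - x j ∣ + ∣ y i - y j ∣
      <⟨ +-mono-< (hx i j (ℕ.m⊔n≤o⇒m≤o M N p) (ℕ.m⊔n≤o⇒m≤o M N q))
                  (hy i j (ℕ.m⊔n≤o⇒n≤o M N p) (ℕ.m⊔n≤o⇒n≤o M N q)) ⟩
    ½ * ε + ½ * ε                      ≡⟨ halves ε ⟩
    ε                                  ∎
    where
    open ≤-Reasoning
    regroup : ∀ a b c d → (a + b) - (c + d) ≡ (a - c) + (b - d)
    regroup = solve 4 (λ a b c d → (a :+ b) :- (c :+ d) := (a :- c) :+ (b :- d)) refl
      where open +-*-Solver

  eventuallyBounded : ∀ {x} → Cauchy x →
    ∃[ B ] (Positive B × ∃[ N ] (∀ k → N ℕ.≤ k → ∣ x k ∣ ≤ B))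
  eventuallyBounded {x} cx with cx 1ℚ (positive⁻¹ 1ℚ)
  ... | N , h = 1ℚ + ∣ x N ∣ , positive B>0 , N , λ k p → begin
    ∣ x k ∣                      ≡⟨ cong ∣_∣ (split (x k) (x N)) ⟩
    ∣ (x k - x N) + x N ∣        ≤⟨ ∣p+q∣≤∣p∣+∣q∣ (x k - x N) (x N) ⟩
    ∣ x k - x N ∣ + ∣ x N ∣      ≤⟨ +-monoˡ-≤ ∣ x N ∣ (<⇒≤ (h k N p ℕ.≤-refl)) ⟩
    1ℚ + ∣ x N ∣                 ∎
    where
    open ≤-Reasoning
    B>0 : 0ℚ < 1ℚ + ∣ x N ∣
    B>0 = begin-strict
      0ℚ              <⟨ positive⁻¹ 1ℚ ⟩
      1ℚ              ≡⟨⟩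
      1ℚ + 0ℚ         ≤⟨ +-monoʳ-≤ 1ℚ (0≤∣p∣ (x N)) ⟩
      1ℚ + ∣ x N ∣    ∎
    split : ∀ a b → a ≡ (a - b) + b
    split = solve 2 (λ a b → a := (a :- b) :+ b) refl
      where open +-*-Solver

  -- A factor bounded by B can absorb a difference below δ B ε.
  δ : (B : ℚ) → Positive B → ℚ → ℚ
  δ B B>0 ε = (1/ B) {{pos⇒nonZero B {{B>0}}}} * (½ * ε)

  δ-pos : ∀ B (B>0 : Positive B) {ε} → 0ℚ < ε → 0ℚ < δ B B>0 ε
  δ-pos B B>0 {ε} 0<ε = positive⁻¹ (δ B B>0 ε)
    {{pos*pos⇒pos ((1/ B) {{pos⇒nonZero B {{B>0}}}}) {{1/pos⇒pos B {{B>0}}}}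
                  (½ * ε) {{positive (half-pos 0<ε)}}}}

  bounded*small : ∀ B (B>0 : Positive B) ε a b →
    ∣ a ∣ ≤ B → ∣ b ∣ < δ B B>0 ε → ∣ a * b ∣ < ½ * ε
  bounded*small B B>0 ε a b a≤B b<δ = begin-strict
    ∣ a * b ∣                ≡⟨ ∣p*q∣≡∣p∣*∣q∣ a b ⟩
    ∣ a ∣ * ∣ b ∣            ≤⟨ *-monoʳ-≤-nonNeg ∣ b ∣ {{ℚ.nonNegative (0≤∣p∣ b)}} a≤B ⟩
    B * ∣ b ∣                <⟨ *-monoʳ-<-pos B {{B>0}} b<δ ⟩
    B * (1/B * (½ * ε))      ≡⟨ assoc B 1/B (½ * ε) ⟩
    (B * 1/B) * (½ * ε)      ≡⟨ cong (_* (½ * ε)) (*-inverseʳ B {{pos⇒nonZero B {{B>0}}}}) ⟩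
    1ℚ * (½ * ε)             ≡⟨ unit (½ * ε) ⟩
    ½ * ε                    ∎
    where
    open ≤-Reasoning
    1/B : ℚ
    1/B = (1/ B) {{pos⇒nonZero B {{B>0}}}}
    assoc : ∀ p q r → p * (q * r) ≡ (p * q) * r
    assoc = solve 3 (λ p q r → p :* (q :* r) := (p :* q) :* r) refl
      where open +-*-Solver
    unit : ∀ p → 1ℚ * p ≡ p
    unit = solve 1 (λ p → con 1ℚ :* p := p) refl
      where open +-*-Solver

  product-close : ∀ {ε} a b c d →
    ∣ a * (b - d) ∣ < ½ * ε → ∣ d * (a - c) ∣ < ½ * ε → ∣ a * b - c * d ∣ < ε
  product-close {ε} a b c d p q = begin-strict
    ∣ a * b - c * d ∣                      ≡⟨ cong ∣_∣ (regroup a b c d) ⟩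
    ∣ a * (b - d) + d * (a - c) ∣          ≤⟨ ∣p+q∣≤∣p∣+∣q∣ (a * (b - d)) (d * (a - c)) ⟩
    ∣ a * (b - d) ∣ + ∣ d * (a - c) ∣      <⟨ +-mono-< p q ⟩
    ½ * ε + ½ * ε                          ≡⟨ halves ε ⟩
    ε                                      ∎
    where
    open ≤-Reasoning
    regroup : ∀ a b c d → a * b - c * d ≡ a * (b - d) + d * (a - c)
    regroup = solve 4
      (λ a b c d → a :* b :- c :* d := a :* (b :- d) :+ d :* (a :- c)) refl
      where open +-*-Solver

  *-cauchy : ∀ x y → Cauchy x → Cauchy y → Cauchy (λ k → x k * y k)
  *-cauchy x y cx cy ε 0<ε =
    let B , B>0 , M , x≤B = eventuallyBounded cx
        C , C>0 , N , y≤C = eventuallyBounded cy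
        M′ , hx = cx (δ C C>0 ε) (δ-pos C C>0 0<ε)
        N′ , hy = cy (δ B B>0 ε) (δ-pos B B>0 0<ε)
    in (M ⊔ N) ⊔ (M′ ⊔ N′) , λ i j p q →
    let p₁ = ℕ.m⊔n≤o⇒m≤o (M ⊔ N) (M′ ⊔ N′) p
        p₂ = ℕ.m⊔n≤o⇒n≤o (M ⊔ N) (M′ ⊔ N′) p
        q₁ = ℕ.m⊔n≤o⇒m≤o (M ⊔ N) (M′ ⊔ N′) q
        q₂ = ℕ.m⊔n≤o⇒n≤o (M ⊔ N) (M′ ⊔ N′) q
    in product-close (x i) (y i) (x j) (y j)
         (bounded*small B B>0 ε (x i) (y i - y j) (x≤B i (ℕ.m⊔n≤o⇒m≤o M N p₁))
           (hy i j (ℕ.m⊔n≤o⇒n≤o M′ N′ p₂) (ℕ.m⊔n≤o⇒n≤o M′ N′ q₂)))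
         (bounded*small C C>0 ε (y j) (x i - x j) (y≤C j (ℕ.m⊔n≤o⇒n≤o M N q₁))
           (hx i j (ℕ.m⊔n≤o⇒m≤o M′ N′ p₂) (ℕ.m⊔n≤o⇒m≤o M′ N′ q₂)))

infixl 6 _+ᵣ_
infixl 7 _*ᵣ_

_+ᵣ_ : ℝ → ℝ → ℝ
x +ᵣ y = (λ k → seq x k + seq y k) ,ᶜ +-cauchy (seq x) (seq y) (cauchy x) (cauchy y)

_*ᵣ_ : ℝ → ℝ → ℝ
x *ᵣ y = (λ k → seq x k * seq y k) ,ᶜ *-cauchy (seq x) (seq y) (cauchy x) (cauchy y)

+ᵣ-rawMonoid : RawMonoid _ _
+ᵣ-rawMonoid = record { Carrier = ℝ ; _≈_ = _≃ᵣ_ ; _∙_ = _+ᵣ_ ; ε = 0ᵣ }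

open RawMonoidDefs +ᵣ-rawMonoid public using (sum)

------------------------------------------------------------------------
-- Matrices

Matrix : Set → ℕ → ℕ → Set
Matrix A m n = Vector (Vector A n) m

infixr 6 _∥_

-- Horizontal juxtaposition; vertical juxtaposition is _++_ on the rows.
_∥_ : ∀ {A m n p} → Matrix A m n → Matrix A m p → Matrix A m (n ℕ.+ p)
(M ∥ N) i = M i ++ N i

-- The (i , j) entry is a at position (j - i) mod N.
Circ : ∀ {A N} → Vector A N → Matrix A N N
Circ {N = N} a i j = a (((toℕ j ℕ.+ (N ∸ toℕ i)) mod N) {{Fin.nonZeroIndex i}})

identity : ∀ N → Matrix ℚ N N
identity N i j = if does (i Fin.≟ j) then 1ℚ else 0ℚ

constant : ∀ m n → ℚ → Matrix ℚ m n
constant _ _ q _ _ = q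

dot : ∀ {N} → Vector ℝ N → Vector ℝ N → ℝ
dot u v = sum (λ i → u i *ᵣ v i)

infixr 7 _*ᵥ_

_*ᵥ_ : ∀ {m n} → Matrix ℝ m n → Vector ℝ n → Vector ℝ m
(M *ᵥ z) i = dot (M i) z

PositiveSemidefinite : ∀ {N} → Matrix ℝ N N → Set
PositiveSemidefinite {N} M =
  (∀ i j → M i j ≃ᵣ M j i) ×
  (∀ (z : Vector ℝ N) → 0ᵣ ≤ᵣ dot z (M *ᵥ z))

toReal : ∀ {m n} → Matrix ℚ m n → Matrix ℝ m n
toReal M i j = fromℚ (M i j)

------------------------------------------------------------------------
-- The matrix L. All entries are rational, so it is built over ℚ.

α : (m k : ℕ) → ℤ
α m k = -1ℤ ℤ.^ (k ℕ.+ 1) ℤ.*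
  (+ 2 ℤ.* (+ m) ℤ.^ 2 ℤ.- + 6 ℤ.* (+ m ℤ.- + k) ℤ.^ 2 ℤ.+ + 7)

-- The entries of 6(n-1)x and (n-1)y, at positions counted from 0.
xNumerator : ℕ → ℕ → ℤ
xNumerator n zero        = (+ n) ℤ.^ 2 ℤ.+ + 4 ℤ.* + n ℤ.- + 12
xNumerator n k@(suc _)   = if k ≤ᵇ m then α m k else α m (n ∸ 1 ∸ k)
  where
  m : ℕ
  m = (n ∸ 1) ℕ./ 2

yNumerator : ℕ → ℕ → ℤ
yNumerator n zero      = + 2 ℤ.- + n
yNumerator n k@(suc _) = -1ℤ ℤ.^ k

x : ∀ n → Vector ℚ (n ∸ 1)
x n i = (xNumerator n (toℕ i) / (6 ℕ.* (n ∸ 1)))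
  {{ℕ.m*n≢0 6 (n ∸ 1) {{_}} {{Fin.nonZeroIndex i}}}}

y : ∀ n → Vector ℚ (n ∸ 1)
y n i = (yNumerator n (toℕ i) / (n ∸ 1)) {{Fin.nonZeroIndex i}}

L : ∀ n → let N = n ∸ 1 in Matrix ℚ (1 ℕ.+ (N ℕ.+ N)) (1 ℕ.+ (N ℕ.+ N))
L n = (constant 1 1 (+ N / 2) ∥ constant 1 N (- ½) ∥ constant 1 N 0ℚ)
   ++ (constant N 1 (- ½)     ∥ A                  ∥ B)
   ++ (constant N 1 0ℚ        ∥ B                  ∥ identity N)
  where
  N : ℕ
  N = n ∸ 1
  A B : Matrix ℚ N N
  A = Circ (x n)
  B = Circ (y n)

{-# OPTIONS --safe #-}

-- Let N = n - 1 = 2m, r = 1/N and sᵢ = (-1)ⁱ. Then B = r s s′ - I, while Aᵢⱼ = δᵢⱼ + (r/6) sᵢ sⱼ (κ(|i - j|) - 6)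
-- with the quadratic kernel κ(d) = N² - 1 - 6 N d + 6 d². For z = (t, u, v), put wᵢ = sᵢ uᵢ, P = ∑ wᵢ and
-- S = ∑ uᵢ. Completing squares in v and t leaves (r/6) (∑∑ wᵢ wⱼ κ(|i - j|) - 3 S²). Written with the partial
-- sums Wₖ of w, the double sum is (3/N) times the sum of the squares of
-- dₖ = 2 N Wₖ - 2 ∑ Wⱼ + P (N + 1 - 2k) for 1 ≤ k ≤ N, and ∑ sₖ dₖ = - N S, so that the remainder is the sum
-- of squares (r²/2) ∑ (dₖ + S sₖ)². The form is thus a sum of squares over ℚ, hence nonnegative along any
-- Cauchy sequences representing real t, u, v.

module Submission where

open import Defs hiding (sum)
import Defs
open import Data.Nat.Base using (ℕ; _≤_)
open import Data.Nat.Divisibility.Core using (_∤_)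

open import Data.Rational.Properties hiding (_≟_)
open import Algebra.Properties.CommutativeMonoid.Sum +-0-commutativeMonoid
  using (sum; sum-cong-≗; ∑-distrib-+; sum-replicate-zero)
open import Data.Bool.Base using (true; false)
open import Data.Fin.Base using (Fin; zero; suc; toℕ; _↑ˡ_; _↑ʳ_; splitAt)
open import Data.Fin.Properties using (_≟_; join-splitAt; toℕ<n; toℕ-injective; toℕ-fromℕ<; nonZeroIndex)
open import Data.Integer.Base as ℤ using (ℤ; +_; -1ℤ)
import Data.Integer.Properties as ℤ
open import Data.Nat.Base as ℕ using (zero; suc)
open import Data.Nat.Divisibility.Core using (divides)
import Data.Nat.DivMod as ℕ
import Data.Nat.Properties as ℕ
open import Data.Product.Base using (_×_; _,_)
open import Data.Rational.Base as ℚ hiding (_≤_)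
open import Data.Rational.Solver using (module +-*-Solver)
import Data.Rational.Unnormalised.Base as ℚᵘ
import Data.Rational.Unnormalised.Properties as ℚᵘ
open import Data.Sum.Base using (_⊎_; inj₁; inj₂)
open import Data.Vec.Functional using (Vector)
open import Data.Vec.Functional.Properties using (lookup-++ˡ; lookup-++ʳ)
open import Function.Base using (_∘_)
open import Relation.Binary.PropositionalEquality
open import Relation.Nullary.Decidable.Core using (yes; no)
open import Relation.Nullary.Negation.Core using (contradiction)
open +-*-Solver

-- Embedding the integers in the rationals.

fromℚᵘ-homo-+ : ∀ p q → fromℚᵘ (p ℚᵘ.+ q) ≡ fromℚᵘ p + fromℚᵘ q
fromℚᵘ-homo-+ p q = toℚᵘ-injective (begin
  toℚᵘ (fromℚᵘ (p ℚᵘ.+ q))                  ≈⟨ toℚᵘ-fromℚᵘ (p ℚᵘ.+ q) ⟩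
  p ℚᵘ.+ q                                  ≈⟨ ℚᵘ.+-cong (toℚᵘ-fromℚᵘ p) (toℚᵘ-fromℚᵘ q) ⟨
  toℚᵘ (fromℚᵘ p) ℚᵘ.+ toℚᵘ (fromℚᵘ q)      ≈⟨ toℚᵘ-homo-+ (fromℚᵘ p) (fromℚᵘ q) ⟨
  toℚᵘ (fromℚᵘ p + fromℚᵘ q)                ∎)
  where open ℚᵘ.≃-Reasoning

fromℚᵘ-homo-* : ∀ p q → fromℚᵘ (p ℚᵘ.* q) ≡ fromℚᵘ p * fromℚᵘ q
fromℚᵘ-homo-* p q = toℚᵘ-injective (begin
  toℚᵘ (fromℚᵘ (p ℚᵘ.* q))                  ≈⟨ toℚᵘ-fromℚᵘ (p ℚᵘ.* q) ⟩
  p ℚᵘ.* q                                  ≈⟨ ℚᵘ.*-cong (toℚᵘ-fromℚᵘ p) (toℚᵘ-fromℚᵘ q) ⟨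
  toℚᵘ (fromℚᵘ p) ℚᵘ.* toℚᵘ (fromℚᵘ q)      ≈⟨ toℚᵘ-homo-* (fromℚᵘ p) (fromℚᵘ q) ⟨
  toℚᵘ (fromℚᵘ p * fromℚᵘ q)                ∎)
  where open ℚᵘ.≃-Reasoning

-- Abstract because the gcd hidden in p / 1 makes conversion checking of polynomial identities explode.
abstract
  ι : ℤ → ℚ
  ι p = p / 1

  ι-homo-+ : ∀ p q → ι (p ℤ.+ q) ≡ ι p + ι q
  ι-homo-+ p q = trans
    (cong₂ (λ a b → ι (a ℤ.+ b)) (sym (ℤ.*-identityʳ p)) (sym (ℤ.*-identityʳ q)))
    (fromℚᵘ-homo-+ (ℚᵘ.mkℚᵘ p 0) (ℚᵘ.mkℚᵘ q 0))

  ι-homo-* : ∀ p q → ι (p ℤ.* q) ≡ ι p * ι q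
  ι-homo-* p q = fromℚᵘ-homo-* (ℚᵘ.mkℚᵘ p 0) (ℚᵘ.mkℚᵘ q 0)

  ι-homo‿- : ∀ p → ι (ℤ.- p) ≡ - ι p
  ι-homo‿- p = begin
    ι (ℤ.- p)       ≡⟨ cong ι (ℤ.-1*i≡-i p) ⟨
    ι (-1ℤ ℤ.* p)   ≡⟨ ι-homo-* -1ℤ p ⟩
    - 1ℚ * ι p      ≡⟨ solve 1 (λ a → con (- 1ℚ) :* a := :- a) refl (ι p) ⟩
    - ι p           ∎
    where open ≡-Reasoning

  /≡ι*1/ : ∀ p d .{{_ : ℕ.NonZero d}} → p / d ≡ ι p * (+ 1 / d)
  /≡ι*1/ p (suc d) = trans
    (fromℚᵘ-cong (ℚᵘ.≃-reflexive (cong₂ ℚᵘ.mkℚᵘ (sym (ℤ.*-identityʳ p)) (sym (ℕ.+-identityʳ d)))))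
    (fromℚᵘ-homo-* (ℚᵘ.mkℚᵘ p 0) (ℚᵘ.mkℚᵘ (+ 1) d))

  1/*ι≡1 : ∀ d .{{_ : ℕ.NonZero d}} → (+ 1 / d) * ι (+ d) ≡ 1ℚ
  1/*ι≡1 (suc d) = trans (sym (fromℚᵘ-homo-* (ℚᵘ.mkℚᵘ (+ 1) d) (ℚᵘ.mkℚᵘ (+ suc d) 0)))
    (fromℚᵘ-cong {ℚᵘ.mkℚᵘ (+ 1) d ℚᵘ.* ℚᵘ.mkℚᵘ (+ suc d) 0} {ℚᵘ.1ℚᵘ} (ℚᵘ.*≡* (trans (ℤ.*-identityʳ _)
      (cong (λ k → + 1 ℤ.* + k) (sym (ℕ.*-identityʳ (suc d)))))))

  -- Exports the one equation by which numerals are evaluated outside the abstract block.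
  ι≡/1 : ∀ p → ι p ≡ p / 1
  ι≡/1 _ = refl

⌞_⌟ : ℕ → ℚ
⌞ n ⌟ = ι (+ n)

⌞⌟-suc : ∀ n → ⌞ suc n ⌟ ≡ ⌞ n ⌟ + 1ℚ
⌞⌟-suc n = trans (cong ⌞_⌟ (ℕ.+-comm 1 n)) (trans (ι-homo-+ (+ n) (+ 1)) (cong (λ p → ⌞ n ⌟ + p) (ι≡/1 (+ 1))))

ι-∸ : ∀ {k n} → k ℕ.≤ n → ⌞ n ℕ.∸ k ⌟ ≡ ⌞ n ⌟ - ⌞ k ⌟
ι-∸ {k} {n} k≤n = begin
  ⌞ n ℕ.∸ k ⌟                       ≡⟨ solve 2 (λ a b → a := a :+ b :- b) refl ⌞ n ℕ.∸ k ⌟ ⌞ k ⌟ ⟩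
  ⌞ n ℕ.∸ k ⌟ + ⌞ k ⌟ - ⌞ k ⌟       ≡⟨ cong (_- ⌞ k ⌟) (ι-homo-+ (+ (n ℕ.∸ k)) (+ k)) ⟨
  ⌞ n ℕ.∸ k ℕ.+ k ⌟ - ⌞ k ⌟         ≡⟨ cong (λ j → ⌞ j ⌟ - ⌞ k ⌟) (ℕ.m∸n+n≡m k≤n) ⟩
  ⌞ n ⌟ - ⌞ k ⌟                     ∎
  where open ≡-Reasoning

-- Constants, signs and sums over initial segments.

two three six twelve : ℚ
two    = + 2 / 1
three  = + 3 / 1
six    = + 6 / 1
twelve = + 12 / 1

sign : ℕ → ℚ
sign zero    = 1ℚ
sign (suc k) = - sign k

sign² : ∀ k → sign k * sign k ≡ 1ℚ
sign² zero    = refl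
sign² (suc k) = trans (solve 1 (λ s → (:- s) :* (:- s) := s :* s) refl (sign k)) (sign² k)

sign-+ : ∀ j k → sign (j ℕ.+ k) ≡ sign j * sign k
sign-+ zero    k = sym (*-identityˡ (sign k))
sign-+ (suc j) k = trans (cong -_ (sign-+ j k)) (neg-distribˡ-* (sign j) (sign k))

sign-double : ∀ m → sign (m ℕ.* 2) ≡ 1ℚ
sign-double zero    = refl
sign-double (suc m) = trans (solve 1 (λ a → :- (:- a) := a) refl (sign (m ℕ.* 2))) (sign-double m)

-- The last term is split off, so an induction on the bound reduces each summation formula to a ring
-- identity for its increment.
∑ : ℕ → (ℕ → ℚ) → ℚ
∑ zero    f = 0ℚ
∑ (suc n) f = ∑ n f + f n

∑-cong : ∀ n {f g : ℕ → ℚ} → (∀ i → i ℕ.< n → f i ≡ g i) → ∑ n f ≡ ∑ n g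
∑-cong zero    _  = refl
∑-cong (suc n) eq = cong₂ _+_ (∑-cong n λ i i<n → eq i (ℕ.m<n⇒m<1+n i<n)) (eq n ℕ.≤-refl)

square-nonNeg : ∀ p → 0ℚ ℚ.≤ p * p
square-nonNeg p with ≤-total 0ℚ p
... | inj₁ 0≤p = nonNegative⁻¹ (p * p)
  {{nonNeg*nonNeg⇒nonNeg p {{nonNegative 0≤p}} p {{nonNegative 0≤p}}}}
... | inj₂ p≤0 = subst (0ℚ ℚ.≤_) (solve 1 (λ a → (:- a) :* (:- a) := a :* a) refl p)
  (nonNegative⁻¹ (- p * - p)
    {{nonNeg*nonNeg⇒nonNeg (- p) {{nonNegative 0≤-p}} (- p) {{nonNegative 0≤-p}}}})
  where
  0≤-p : 0ℚ ℚ.≤ - p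
  0≤-p = neg-antimono-≤ p≤0

∑-nonNeg : ∀ n {f : ℕ → ℚ} → (∀ i → 0ℚ ℚ.≤ f i) → 0ℚ ℚ.≤ ∑ n f
∑-nonNeg zero    _  = ≤-refl
∑-nonNeg (suc n) 0≤f = +-mono-≤ (∑-nonNeg n 0≤f) (0≤f n)

-- Up to signs, 6(n-1) times an off-diagonal entry of A is κ - 6. On ℤ/N, κ sums to zero and
-- is 12N times the pseudoinverse of the Laplacian of the N-cycle.
κ : ℚ → ℚ → ℚ
κ N d = N * N - 1ℚ - six * N * d + six * d * d

-- Separates the new column, of weight `c`, when a double sum grows by one index.
∑-addMultiple : ∀ n (f g h : ℕ → ℚ) c →
  ∑ n (λ i → f i * (g i + c * h i)) ≡ ∑ n (λ i → f i * g i) + c * ∑ n (λ i → f i * h i)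
∑-addMultiple zero    f g h c = solve 1 (λ c → con 0ℚ := con 0ℚ :+ c :* con 0ℚ) refl c
∑-addMultiple (suc n) f g h c rewrite ∑-addMultiple n f g h c =
  solve 6 (λ A B f g h c → A :+ c :* B :+ f :* (g :+ c :* h) := A :+ f :* g :+ c :* (B :+ f :* h)) refl
    (∑ n (λ i → f i * g i)) (∑ n (λ i → f i * h i)) (f n) (g n) (h n) c

-- ∑∑ wᵢ wⱼ κ(|i - j|) over i, j < n, in terms of the moments of the partial sums of w.
energy : (N n W F G V : ℚ) → ℚ
energy N n W F G V = (N * N - 1ℚ) * W * W - twelve * N * (W * F - V)
  + twelve * (W * ((two * n + 1ℚ) * F - two * G) - F * F)

-- Counterpart of energy in the syntax of the ring solver.
energyᵖ : ∀ {k} (N n W F G V : Polynomial k) → Polynomial k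
energyᵖ N n W F G V = (N :* N :- con 1ℚ) :* W :* W :- con twelve :* N :* (W :* F :- V)
  :+ con twelve :* (W :* ((con two :* n :+ con 1ℚ) :* F :- con two :* G) :- F :* F)

-- Scaled by twelve so that Faulhaber's formulas have integral coefficients.
dispersion : (p a b c n s F G V A : ℚ) → ℚ
dispersion p a b c n s F G V A =
  twelve * p * p * V + twelve * a * a * n + two * b * b * n * (n + 1ℚ) * (two * n + 1ℚ)
  + twelve * c * c * n + twelve * two * p * (a * F + b * G + c * A)
  + twelve * a * b * n * (n + 1ℚ) + twelve * a * c * (s - 1ℚ)
  + six * b * c * (s * (two * n + 1ℚ) - 1ℚ)

dispersionᵖ : ∀ {k} (p a b c n s F G V A : Polynomial k) → Polynomial k
dispersionᵖ p a b c n s F G V A =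
  con twelve :* p :* p :* V :+ con twelve :* a :* a :* n
  :+ con two :* b :* b :* n :* (n :+ con 1ℚ) :* (con two :* n :+ con 1ℚ)
  :+ con twelve :* c :* c :* n :+ con twelve :* con two :* p :* (a :* F :+ b :* G :+ c :* A)
  :+ con twelve :* a :* b :* n :* (n :+ con 1ℚ) :+ con twelve :* a :* c :* (s :- con 1ℚ)
  :+ con six :* b :* c :* (s :* (con two :* n :+ con 1ℚ) :- con 1ℚ)

-- The kernel form in terms of partial sums

module PartialSums (w : ℕ → ℚ) where

  W F V G A : ℕ → ℚ
  W n = ∑ n w
  F n = ∑ n λ k → W (suc k)
  V n = ∑ n λ k → W (suc k) * W (suc k)
  G n = ∑ n λ k → ⌞ suc k ⌟ * W (suc k)
  A n = ∑ n λ k → sign (suc k) * W (suc k)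

  -- The second moment ∑ (n - j)² wⱼ over j < n, after summation by parts.
  E : ℕ → ℚ
  E n = (two * ⌞ n ⌟ + 1ℚ) * F n - two * G n

  -- `κ` is quadratic, so only moments of `w` up to order two enter. Summation by parts gives ∑ j wⱼ
  -- = n W - F and ∑ j² wⱼ = n² W - 2 G + F.
  ∑-κ : ∀ N x n → ∑ n (λ j → w j * κ N (x - ⌞ j ⌟)) ≡
    (N * N - 1ℚ) * W n - six * N * (x * W n - ⌞ n ⌟ * W n + F n)
      + six * (x * x * W n - two * x * (⌞ n ⌟ * W n - F n) + ⌞ n ⌟ * ⌞ n ⌟ * W n - two * G n + F n)
  ∑-κ N x zero =
    solve 3 (λ N x n →
      let z = con 0ℚ in
      z := (N :* N :- con 1ℚ) :* z :- con six :* N :* (x :* z :- n :* z :+ z)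
             :+ con six :* (x :* x :* z :- con two :* x :* (n :* z :- z) :+ n :* n :* z :- con two :* z :+ z))
      refl N x ⌞ 0 ⌟
  ∑-κ N x (suc n) rewrite ⌞⌟-suc n | ∑-κ N x n =
    solve 7 (λ N x n w W F G →
      let row = λ n W F G → (N :* N :- con 1ℚ) :* W :- con six :* N :* (x :* W :- n :* W :+ F)
                :+ con six :* (x :* x :* W :- con two :* x :* (n :* W :- F) :+ n :* n :* W :- con two :* G :+ F)
          d = x :- n
      in row n W F G :+ w :* (N :* N :- con 1ℚ :- con six :* N :* d :+ con six :* d :* d)
         := row (n :+ con 1ℚ) (W :+ w) (F :+ (W :+ w)) (G :+ (n :+ con 1ℚ) :* (W :+ w)))
      refl N x ⌞ n ⌟ (w n) (W n) (F n) (G n)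

  kernel : ℚ → ℕ → ℕ → ℚ
  kernel N i j = κ N ⌞ ℕ.∣ i - j ∣ ⌟

  kernel-≥ : ∀ N {j n} → j ℕ.≤ n → kernel N n j ≡ κ N (⌞ n ⌟ - ⌞ j ⌟)
  kernel-≥ N j≤n = cong (κ N) (trans (cong ⌞_⌟ (ℕ.m≤n⇒∣n-m∣≡n∸m j≤n)) (ι-∸ j≤n))

  row : ℚ → ℕ → ℕ → ℚ
  row N n i = ∑ n (λ j → w j * kernel N i j)

  -- The index n exceeds every summation index, so the absolute value drops and `∑-κ` applies at x =
  -- n.
  row-last : ∀ N n → row N n n ≡ (N * N - 1ℚ) * W n - six * N * F n + six * E n
  row-last N n = begin
    row N n n
      ≡⟨ ∑-cong n (λ j j<n → cong (w j *_) (kernel-≥ N (ℕ.<⇒≤ j<n))) ⟩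
    ∑ n (λ j → w j * κ N (⌞ n ⌟ - ⌞ j ⌟))
      ≡⟨ ∑-κ N ⌞ n ⌟ n ⟩
    _ ≡⟨ solve 5 (λ N x W F G →
           (N :* N :- con 1ℚ) :* W :- con six :* N :* (x :* W :- x :* W :+ F)
             :+ con six :* (x :* x :* W :- con two :* x :* (x :* W :- F) :+ x :* x :* W :- con two :* G :+ F)
           := (N :* N :- con 1ℚ) :* W :- con six :* N :* F
             :+ con six :* ((con two :* x :+ con 1ℚ) :* F :- con two :* G))
         refl N ⌞ n ⌟ (W n) (F n) (G n) ⟩
    (N * N - 1ℚ) * W n - six * N * F n + six * E n ∎
    where open ≡-Reasoning

  -- Borders the n by n square: the new row and column agree because |i - j| is symmetric, and the
  -- corner is κ(0) = N² - 1.
  ∑∑-kernel-suc : ∀ N n → ∑ (suc n) (λ i → w i * row N (suc n) i) ≡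
    ∑ n (λ i → w i * row N n i) + w n * row N n n + w n * (row N n n + w n * (N * N - 1ℚ))
  ∑∑-kernel-suc N n = cong₂ _+_
    (begin
      ∑ n (λ i → w i * row N (suc n) i)
        ≡⟨ ∑-addMultiple n w (row N n) (λ i → kernel N i n) (w n) ⟩
      ∑ n (λ i → w i * row N n i) + w n * ∑ n (λ i → w i * kernel N i n)
        ≡⟨ cong (λ t → ∑ n (λ i → w i * row N n i) + w n * t)
             (∑-cong n λ i _ → cong (λ d → w i * κ N ⌞ d ⌟) (ℕ.∣-∣-comm i n)) ⟩
      ∑ n (λ i → w i * row N n i) + w n * row N n n ∎)
    (cong (λ t → w n * (row N n n + w n * t))
      (begin
        kernel N n n               ≡⟨ kernel-≥ N (ℕ.≤-refl {n}) ⟩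
        κ N (⌞ n ⌟ - ⌞ n ⌟)
          ≡⟨ solve 2 (λ N x → N :* N :- con 1ℚ :- con six :* N :* (x :- x) :+ con six :* (x :- x) :* (x :- x)
               := N :* N :- con 1ℚ) refl N ⌞ n ⌟ ⟩
        N * N - 1ℚ                 ∎))
    where open ≡-Reasoning

  -- The period `N` is kept apart from the bound `n`, so that induction on `n` leaves the kernel
  -- fixed.
  ∑∑-kernel : ∀ N n → ∑ n (λ i → w i * row N n i) ≡ energy N ⌞ n ⌟ (W n) (F n) (G n) (V n)
  ∑∑-kernel N zero    = solve 2 (λ N n → con 0ℚ := energyᵖ N n (con 0ℚ) (con 0ℚ) (con 0ℚ) (con 0ℚ))
    refl N ⌞ 0 ⌟
  ∑∑-kernel N (suc n) = begin
    ∑ (suc n) (λ i → w i * row N (suc n) i)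
      ≡⟨ ∑∑-kernel-suc N n ⟩
    ∑ n (λ i → w i * row N n i) + w n * row N n n + w n * (row N n n + w n * (N * N - 1ℚ))
      ≡⟨ cong₂ (λ D R → D + w n * R + w n * (R + w n * (N * N - 1ℚ))) (∑∑-kernel N n) (row-last N n) ⟩
    _ ≡⟨ solve 7 (λ N n w W F G V →
           let R  = (N :* N :- con 1ℚ) :* W :- con six :* N :* F
                      :+ con six :* ((con two :* n :+ con 1ℚ) :* F :- con two :* G)
               W⁺ = W :+ w
           in energyᵖ N n W F G V :+ w :* R :+ w :* (R :+ w :* (N :* N :- con 1ℚ))
              := energyᵖ N (n :+ con 1ℚ) W⁺ (F :+ W⁺) (G :+ (n :+ con 1ℚ) :* W⁺) (V :+ W⁺ :* W⁺))
         refl N ⌞ n ⌟ (w n) (W n) (F n) (G n) (V n) ⟩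
    energy N (⌞ n ⌟ + 1ℚ) (W (suc n)) (F (suc n)) (G n + (⌞ n ⌟ + 1ℚ) * W (suc n)) (V (suc n))
      ≡⟨ cong (λ x → energy N x (W (suc n)) (F (suc n)) (G n + x * W (suc n)) (V (suc n))) (⌞⌟-suc n) ⟨
    energy N ⌞ suc n ⌟ (W (suc n)) (F (suc n)) (G (suc n)) (V (suc n)) ∎
    where open ≡-Reasoning

  -- Summation by parts: with s the sign, sₖ₊₁ - sₖ = 2 sₖ₊₁.
  ∑-alternating : ∀ n → ∑ n (λ i → sign i * w i) ≡ sign n * W n - two * A n
  ∑-alternating zero    = refl
  ∑-alternating (suc n) = trans (cong (_+ sign n * w n) (∑-alternating n))
    (solve 4 (λ s w W A → s :* W :- con two :* A :+ s :* w
      := (:- s) :* (W :+ w) :- con two :* (A :+ (:- s) :* (W :+ w)))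
      refl (sign n) (w n) (W n) (A n))

  -- The intended coefficients involve totals up to N; leaving them free allows induction on the
  -- number of squares.
  residual : (p a b c : ℚ) → ℕ → ℚ
  residual p a b c k = p * W k + a + b * ⌞ k ⌟ + c * sign k

  -- Besides the terms in W, expanding the square needs ∑ k, ∑ k², ∑ (-1)ᵏ = (s - 1)/2 and ∑ k (-1)ᵏ
  -- = (s (2n + 1) - 1)/4 over 1 ≤ k ≤ n, where s = (-1)ⁿ.
  ∑-residual² : ∀ p a b c n →
    twelve * ∑ n (λ k → residual p a b c (suc k) * residual p a b c (suc k)) ≡
    dispersion p a b c ⌞ n ⌟ (sign n) (F n) (G n) (V n) (A n)
  ∑-residual² p a b c zero = trans
    (solve 4 (λ p a b c → con twelve :* con 0ℚ
       := dispersionᵖ p a b c (con 0ℚ) (con 1ℚ) (con 0ℚ) (con 0ℚ) (con 0ℚ) (con 0ℚ))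
     refl p a b c)
    (cong (λ x → dispersion p a b c x 1ℚ 0ℚ 0ℚ 0ℚ 0ℚ) (sym (ι≡/1 (+ 0))))
  ∑-residual² p a b c (suc n) = begin
    twelve * (S + residual p a b c (suc n) * residual p a b c (suc n))
      ≡⟨ cong (λ k → twelve * (S + (p * W′ + a + b * k + c * - s) * (p * W′ + a + b * k + c * - s))) (⌞⌟-suc n) ⟩
    twelve * (S + (p * W′ + a + b * n⁺ + c * - s) * (p * W′ + a + b * n⁺ + c * - s))
      -- The ring solver cannot use s² = 1, so the square is expanded until s * s stands alone for
      -- `sign²`.
      ≡⟨ solve 8 (λ S p W a b c x s →
           let d = p :* W :+ a :+ b :* x in
           con twelve :* (S :+ (d :+ c :* (:- s)) :* (d :+ c :* (:- s)))
           := con twelve :* S :+ con twelve :* (d :* d :- con two :* c :* s :* d :+ c :* c :* (s :* s)))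
         refl S p W′ a b c n⁺ s ⟩
    twelve * S + twelve * (d * d - two * c * s * d + c * c * (s * s))
      ≡⟨ cong₂ (λ S e → S + twelve * (d * d - two * c * s * d + c * c * e)) (∑-residual² p a b c n) (sign² n) ⟩
    dispersion p a b c ⌞ n ⌟ s (F n) (G n) (V n) (A n) + twelve * (d * d - two * c * s * d + c * c * 1ℚ)
      ≡⟨ solve 11 (λ p a b c n s F G V A W →
           let x = n :+ con 1ℚ
               d = p :* W :+ a :+ b :* x
           in dispersionᵖ p a b c n s F G V A
                :+ con twelve :* (d :* d :- con two :* c :* s :* d :+ c :* c :* con 1ℚ)
              := dispersionᵖ p a b c x (:- s) (F :+ W) (G :+ x :* W) (V :+ W :* W) (A :+ (:- s) :* W))
         refl p a b c ⌞ n ⌟ s (F n) (G n) (V n) (A n) W′ ⟩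
    dispersion p a b c n⁺ (- s) (F n + W′) (G n + n⁺ * W′) (V n + W′ * W′) (A n + - s * W′)
      ≡⟨ cong (λ x → dispersion p a b c x (- s) (F n + W′) (G n + x * W′) (V n + W′ * W′) (A n + - s * W′)) (⌞⌟-suc n) ⟨
    dispersion p a b c ⌞ suc n ⌟ (sign (suc n)) (F (suc n)) (G (suc n)) (V (suc n)) (A (suc n)) ∎
    where
    open ≡-Reasoning
    S W′ n⁺ s d : ℚ
    S  = ∑ n (λ k → residual p a b c (suc k) * residual p a b c (suc k))
    W′ = W (suc n)
    n⁺ = ⌞ n ⌟ + 1ℚ
    s  = sign n
    d  = p * W′ + a + b * n⁺

  -- The value is dₖ + S sₖ, where dₖ is 2N times the difference between Wₖ - k P/N and its mean
  -- over 1 ≤ k ≤ N, with P = W N.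
  centred : ℕ → ℕ → ℚ
  centred N = residual (two * ⌞ N ⌟) (W N * (⌞ N ⌟ + 1ℚ) - two * F N) (- (two * W N)) (∑ N (λ i → sign i * w i))

  -- For even N, ∑ sₖ dₖ = - N S, while ∑ sₖ² = N. Hence ∑ dₖ² = ∑ (dₖ + S sₖ)² + N S², and the left
  -- side is 3 ∑ dₖ².
  energy-decomposition : ∀ N → sign N ≡ 1ℚ →
    let S = ∑ N (λ i → sign i * w i) in
    ⌞ N ⌟ * ∑ N (λ i → w i * row ⌞ N ⌟ N i) ≡
    three * ∑ N (λ k → centred N (suc k) * centred N (suc k)) + three * ⌞ N ⌟ * S * S
  energy-decomposition N even = begin
    ν * ∑ N (λ i → w i * row ν N i)
      ≡⟨ cong (ν *_) (∑∑-kernel ν N) ⟩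
    ν * energy ν ν (W N) (F N) (G N) (V N)
      -- The factor 1/4 is 3/12, since `dispersion` carries a factor 12. S is written as 1 * W - 2 A
      -- to make the identity polynomial; `∑-alternating` restores it next.
      ≡⟨ solve 6 (λ ν W F G V A →
           let S = con 1ℚ :* W :- con two :* A in
           ν :* energyᵖ ν ν W F G V
           := con (+ 1 / 4) :* dispersionᵖ (con two :* ν) (W :* (ν :+ con 1ℚ) :- con two :* F) (:- (con two :* W)) S
                ν (con 1ℚ) F G V A :+ con three :* ν :* S :* S)
         refl ν (W N) (F N) (G N) (V N) (A N) ⟩
    ¼ * disp (1ℚ * W N - two * A N) 1ℚ + three * ν * (1ℚ * W N - two * A N) * (1ℚ * W N - two * A N)
      ≡⟨ cong₂ (λ S s → ¼ * disp S s + three * ν * S * S)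
           (trans (cong (λ s → s * W N - two * A N) (sym even)) (sym (∑-alternating N))) (sym even) ⟩
    ¼ * disp S (sign N) + three * ν * S * S
      ≡⟨ cong (λ t → ¼ * t + three * ν * S * S) (∑-residual² p a b S N) ⟨
    ¼ * (twelve * Z) + three * ν * S * S
      ≡⟨ solve 3 (λ Z ν S → con (+ 1 / 4) :* (con twelve :* Z) :+ con three :* ν :* S :* S
           := con three :* Z :+ con three :* ν :* S :* S) refl Z ν S ⟩
    three * Z + three * ν * S * S ∎
    where
    open ≡-Reasoning
    ν p a b S ¼ Z : ℚ
    ν = ⌞ N ⌟
    p = two * ν
    a = W N * (ν + 1ℚ) - two * F N
    b = - (two * W N)
    S = ∑ N (λ i → sign i * w i)
    ¼ = + 1 / 4
    Z = ∑ N (λ k → centred N (suc k) * centred N (suc k))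
    disp : ℚ → ℚ → ℚ
    disp c s = dispersion p a b c ν s (F N) (G N) (V N) (A N)

-- Entries of x and y

ι-sub : ∀ p q → ι (p ℤ.- q) ≡ ι p - ι q
ι-sub p q = trans (ι-homo-+ p (ℤ.- q)) (cong (λ t → ι p + t) (ι-homo‿- q))

ι-square : ∀ p → ι (p ℤ.^ 2) ≡ ι p * ι p
ι-square p = trans (cong (λ q → ι (p ℤ.* q)) (ℤ.*-identityʳ p)) (ι-homo-* p p)

ι-[-1]^ : ∀ k → ι (-1ℤ ℤ.^ k) ≡ sign k
ι-[-1]^ zero    = ι≡/1 (+ 1)
ι-[-1]^ (suc k) = begin
  ι (-1ℤ ℤ.* -1ℤ ℤ.^ k)   ≡⟨ cong ι (ℤ.-1*i≡-i (-1ℤ ℤ.^ k)) ⟩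
  ι (ℤ.- (-1ℤ ℤ.^ k))     ≡⟨ ι-homo‿- (-1ℤ ℤ.^ k) ⟩
  - ι (-1ℤ ℤ.^ k)         ≡⟨ cong -_ (ι-[-1]^ k) ⟩
  - sign k                ∎
  where open ≡-Reasoning

-- Makes `κ` a function of distance on the N-cycle: an offset and its wraparound give the same
-- value.
κ-reflect : ∀ N d → κ N (N - d) ≡ κ N d
κ-reflect = solve 2 (λ N d → N :* N :- con 1ℚ :- con six :* N :* (N :- d) :+ con six :* (N :- d) :* (N :- d)
  := N :* N :- con 1ℚ :- con six :* N :* d :+ con six :* d :* d) refl

signedKernel : ℕ → ℕ → ℚ
signedKernel N k = sign k * (κ ⌞ N ⌟ ⌞ k ⌟ - six)

-- Accounts for the second half of x mirroring the first: for even N neither the sign nor `κ`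
-- changes under reflection.
signedKernel-reflect : ∀ {N k} → sign N ≡ 1ℚ → k ℕ.≤ N → signedKernel N (N ℕ.∸ k) ≡ signedKernel N k
signedKernel-reflect {N} {k} even k≤N = cong₂ (λ s t → s * (t - six))
  (begin
    sign (N ℕ.∸ k)                       ≡⟨ *-identityʳ (sign (N ℕ.∸ k)) ⟨
    sign (N ℕ.∸ k) * 1ℚ                  ≡⟨ cong (sign (N ℕ.∸ k) *_) (sign² k) ⟨
    sign (N ℕ.∸ k) * (sign k * sign k)   ≡⟨ *-assoc (sign (N ℕ.∸ k)) (sign k) (sign k) ⟨
    sign (N ℕ.∸ k) * sign k * sign k     ≡⟨ cong (_* sign k) (sign-+ (N ℕ.∸ k) k) ⟨
    sign (N ℕ.∸ k ℕ.+ k) * sign k        ≡⟨ cong (λ n → sign n * sign k) (ℕ.m∸n+n≡m k≤N) ⟩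
    sign N * sign k                      ≡⟨ cong (_* sign k) even ⟩
    1ℚ * sign k                          ≡⟨ *-identityˡ (sign k) ⟩
    sign k                               ∎)
  (trans (cong (κ ⌞ N ⌟) (ι-∸ k≤N)) (κ-reflect ⌞ N ⌟ ⌞ k ⌟))
  where open ≡-Reasoning

-- With N = 2m, the bracket 2m² - 6(m - k)² + 7 is 6 - κ(k), and the exponent k + 1 absorbs the
-- minus sign.
ι-α : ∀ m k → ι (α m k) ≡ signedKernel (m ℕ.* 2) k
ι-α m k = begin
  ι (α m k)
    ≡⟨ ι-homo-* (-1ℤ ℤ.^ (k ℕ.+ 1)) _ ⟩
  ι (-1ℤ ℤ.^ (k ℕ.+ 1)) * ι (+ 2 ℤ.* (+ m) ℤ.^ 2 ℤ.- + 6 ℤ.* (+ m ℤ.- + k) ℤ.^ 2 ℤ.+ + 7)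
    ≡⟨ cong₂ _*_ (trans (ι-[-1]^ (k ℕ.+ 1)) (cong sign (ℕ.+-comm k 1)))
         (trans (ι-homo-+ _ (+ 7)) (cong₂ _+_
           (trans (ι-sub _ (+ 6 ℤ.* (+ m ℤ.- + k) ℤ.^ 2)) (cong₂ _-_
             (trans (ι-homo-* (+ 2) ((+ m) ℤ.^ 2)) (cong₂ _*_ (ι≡/1 (+ 2)) (ι-square (+ m))))
             (trans (ι-homo-* (+ 6) ((+ m ℤ.- + k) ℤ.^ 2))
               (cong₂ _*_ (ι≡/1 (+ 6))
                 (trans (ι-square (+ m ℤ.- + k)) (cong (λ p → p * p) (ι-sub (+ m) (+ k))))))))
           (ι≡/1 (+ 7)))) ⟩
  - sign k * (two * (⌞ m ⌟ * ⌞ m ⌟) - six * ((⌞ m ⌟ - ⌞ k ⌟) * (⌞ m ⌟ - ⌞ k ⌟)) + (+ 7 / 1))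
    ≡⟨ solve 3 (λ s m k →
         let N = m :* con two in
         (:- s) :* (con two :* (m :* m) :- con six :* ((m :- k) :* (m :- k)) :+ con (+ 7 / 1))
         := s :* (N :* N :- con 1ℚ :- con six :* N :* k :+ con six :* k :* k :- con six))
       refl (sign k) ⌞ m ⌟ ⌞ k ⌟ ⟩
  sign k * (κ (⌞ m ⌟ * two) ⌞ k ⌟ - six)
    ≡⟨ cong (λ N → sign k * (κ N ⌞ k ⌟ - six))
         (trans (cong ι (ℤ.pos-* m 2)) (trans (ι-homo-* (+ m) (+ 2)) (cong (⌞ m ⌟ *_) (ι≡/1 (+ 2))))) ⟨
  signedKernel (m ℕ.* 2) k ∎
  where open ≡-Reasoning

-- The convolution unit: absorbs the exceptional entries of x and y at position 0.
unit : ℕ → ℚ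
unit zero    = 1ℚ
unit (suc _) = 0ℚ

-- At position 0, n² + 4n - 12 = 6N + κ(0) - 6, so the exceptional entry differs from the general
-- formula by 6N. This surplus becomes the identity part of A.
ι-xNumerator : ∀ m k → k ℕ.≤ m ℕ.* 2 →
  ι (xNumerator (suc (m ℕ.* 2)) k) ≡ six * ⌞ m ℕ.* 2 ⌟ * unit k + signedKernel (m ℕ.* 2) k
ι-xNumerator m zero    _   = begin
  ι ((+ n) ℤ.^ 2 ℤ.+ + 4 ℤ.* + n ℤ.- + 12)
    ≡⟨ trans (ι-sub ((+ n) ℤ.^ 2 ℤ.+ + 4 ℤ.* + n) (+ 12)) (cong₂ _-_
         (trans (ι-homo-+ ((+ n) ℤ.^ 2) (+ 4 ℤ.* + n)) (cong₂ _+_ (ι-square (+ n))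
           (trans (ι-homo-* (+ 4) (+ n)) (cong (_* ⌞ n ⌟) (ι≡/1 (+ 4))))))
         (ι≡/1 (+ 12))) ⟩
  ⌞ n ⌟ * ⌞ n ⌟ + (+ 4 / 1) * ⌞ n ⌟ - twelve
    ≡⟨ cong (λ x → x * x + (+ 4 / 1) * x - twelve) (⌞⌟-suc N) ⟩
  (⌞ N ⌟ + 1ℚ) * (⌞ N ⌟ + 1ℚ) + (+ 4 / 1) * (⌞ N ⌟ + 1ℚ) - twelve
    ≡⟨ solve 1 (λ N → (N :+ con 1ℚ) :* (N :+ con 1ℚ) :+ con (+ 4 / 1) :* (N :+ con 1ℚ) :- con twelve
         := con six :* N :* con 1ℚ
           :+ con 1ℚ :* (N :* N :- con 1ℚ :- con six :* N :* con 0ℚ :+ con six :* con 0ℚ :* con 0ℚ :- con six))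
       refl ⌞ N ⌟ ⟩
  six * ⌞ N ⌟ * 1ℚ + 1ℚ * (κ ⌞ N ⌟ 0ℚ - six)
    ≡⟨ cong (λ z → six * ⌞ N ⌟ * 1ℚ + 1ℚ * (κ ⌞ N ⌟ z - six)) (ι≡/1 (+ 0)) ⟨
  six * ⌞ N ⌟ * 1ℚ + signedKernel N 0 ∎
  where
  open ≡-Reasoning
  N n : ℕ
  N = m ℕ.* 2
  n = suc N
ι-xNumerator m (suc k) k≤N = trans (value k≤N)
  (solve 2 (λ N s → s := con six :* N :* con 0ℚ :+ s) refl ⌞ m ℕ.* 2 ⌟ (signedKernel (m ℕ.* 2) (suc k)))
  where
  value : suc k ℕ.≤ m ℕ.* 2 → ι (xNumerator (suc (m ℕ.* 2)) (suc k)) ≡ signedKernel (m ℕ.* 2) (suc k)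
  -- The midpoint is computed as 2m / 2 and must become m before the comparison is split.
  value k≤N rewrite ℕ.m*n/n≡m m 2 {{_}} with suc k ℕ.≤ᵇ m
  ... | true  = ι-α m (suc k)
  ... | false = trans (ι-α m (m ℕ.* 2 ℕ.∸ suc k)) (signedKernel-reflect (sign-double m) k≤N)

ι-yNumerator : ∀ N k → ι (yNumerator (suc N) k) ≡ sign k - ⌞ N ⌟ * unit k
ι-yNumerator N zero    = begin
  ι (+ 2 ℤ.- + suc N)         ≡⟨ ι-sub (+ 2) (+ suc N) ⟩
  ι (+ 2) - ⌞ suc N ⌟         ≡⟨ cong₂ _-_ (ι≡/1 (+ 2)) (⌞⌟-suc N) ⟩
  two - (⌞ N ⌟ + 1ℚ)          ≡⟨ solve 1 (λ N → con two :- (N :+ con 1ℚ) := con 1ℚ :- N :* con 1ℚ) refl ⌞ N ⌟ ⟩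
  1ℚ - ⌞ N ⌟ * 1ℚ             ∎
  where open ≡-Reasoning
ι-yNumerator N (suc k) = trans (ι-[-1]^ (suc k))
  (solve 2 (λ N s → s := s :- N :* con 0ℚ) refl ⌞ N ⌟ (sign (suc k)))

-- Cyclic offsets in circulant matrices.

offset : ∀ {N} → Fin N → Fin N → ℕ
offset {N} i j = (toℕ j ℕ.+ (N ℕ.∸ toℕ i)) ℕ.% N
  where instance _ = nonZeroIndex i

toℕ-mod : ∀ {N} (i j : Fin N) →
  toℕ (((toℕ j ℕ.+ (N ℕ.∸ toℕ i)) ℕ.mod N) {{nonZeroIndex i}}) ≡ offset i j
toℕ-mod {N} i j = toℕ-fromℕ< (ℕ.m%n<n (toℕ j ℕ.+ (N ℕ.∸ toℕ i)) N {{nonZeroIndex i}})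

distance : ∀ {N} → Fin N → Fin N → ℕ
distance i j = ℕ.∣ toℕ i - toℕ j ∣

-- The cases are i ≤ j and j < i, without and with wraparound. The distance formula serves `κ` and
-- `unit`; the additive equation, free of truncated subtraction, serves the signs.
offset-cases : ∀ {N} (i j : Fin N) →
  (offset i j ≡ distance i j × offset i j ℕ.+ toℕ i ≡ toℕ j) ⊎
  (offset i j ≡ N ℕ.∸ distance i j × offset i j ℕ.+ toℕ i ≡ toℕ j ℕ.+ N)
offset-cases {N} i j with ℕ.≤-<-connex (toℕ i) (toℕ j)
... | inj₁ i≤j = inj₁ (trans k≡ (sym (ℕ.m≤n⇒∣m-n∣≡n∸m i≤j)) , trans (cong (ℕ._+ toℕ i) k≡) (ℕ.m∸n+n≡m i≤j))
  where
  instance _ = nonZeroIndex i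
  open ≡-Reasoning
  k≡ : offset i j ≡ toℕ j ℕ.∸ toℕ i
  k≡ = begin
    (toℕ j ℕ.+ (N ℕ.∸ toℕ i)) ℕ.% N   ≡⟨ cong (ℕ._% N) (ℕ.+-∸-assoc (toℕ j) (ℕ.<⇒≤ (toℕ<n i))) ⟨
    (toℕ j ℕ.+ N ℕ.∸ toℕ i) ℕ.% N     ≡⟨ cong (ℕ._% N) (ℕ.+-∸-comm N i≤j) ⟩
    (toℕ j ℕ.∸ toℕ i ℕ.+ N) ℕ.% N     ≡⟨ ℕ.[m+n]%n≡m%n (toℕ j ℕ.∸ toℕ i) N ⟩
    (toℕ j ℕ.∸ toℕ i) ℕ.% N           ≡⟨ ℕ.m<n⇒m%n≡m (ℕ.≤-<-trans (ℕ.m∸n≤m (toℕ j) (toℕ i)) (toℕ<n j)) ⟩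
    toℕ j ℕ.∸ toℕ i                   ∎
... | inj₂ j<i = inj₂ (trans k≡ (trans j+[N∸i] (cong (N ℕ.∸_) (sym (ℕ.m≤n⇒∣n-m∣≡n∸m (ℕ.<⇒≤ j<i))))) , k+i)
  where
  instance _ = nonZeroIndex i
  open ≡-Reasoning
  j+[N∸i] : toℕ j ℕ.+ (N ℕ.∸ toℕ i) ≡ N ℕ.∸ (toℕ i ℕ.∸ toℕ j)
  j+[N∸i] = begin
    toℕ j ℕ.+ (N ℕ.∸ toℕ i)   ≡⟨ ℕ.+-∸-assoc (toℕ j) (ℕ.<⇒≤ (toℕ<n i)) ⟨
    toℕ j ℕ.+ N ℕ.∸ toℕ i     ≡⟨ cong (ℕ._∸ toℕ i) (ℕ.+-comm (toℕ j) N) ⟩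
    N ℕ.+ toℕ j ℕ.∸ toℕ i     ≡⟨ cong (N ℕ.+ toℕ j ℕ.∸_) (ℕ.m∸n+n≡m (ℕ.<⇒≤ j<i)) ⟨
    N ℕ.+ toℕ j ℕ.∸ (toℕ i ℕ.∸ toℕ j ℕ.+ toℕ j) ≡⟨ cong₂ ℕ._∸_ (ℕ.+-comm N (toℕ j)) (ℕ.+-comm (toℕ i ℕ.∸ toℕ j) (toℕ j)) ⟩
    toℕ j ℕ.+ N ℕ.∸ (toℕ j ℕ.+ (toℕ i ℕ.∸ toℕ j)) ≡⟨ ℕ.[m+n]∸[m+o]≡n∸o (toℕ j) N (toℕ i ℕ.∸ toℕ j) ⟩
    N ℕ.∸ (toℕ i ℕ.∸ toℕ j)   ∎
  j+[N∸i]+i : toℕ j ℕ.+ (N ℕ.∸ toℕ i) ℕ.+ toℕ i ≡ toℕ j ℕ.+ N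
  j+[N∸i]+i = trans (ℕ.+-assoc (toℕ j) _ _) (cong (toℕ j ℕ.+_) (ℕ.m∸n+n≡m (ℕ.<⇒≤ (toℕ<n i))))
  small : toℕ j ℕ.+ (N ℕ.∸ toℕ i) ℕ.< N
  small = ℕ.+-cancelʳ-< (toℕ i) _ _
    (subst (ℕ._< N ℕ.+ toℕ i) (sym j+[N∸i]+i)
      (subst (ℕ._< N ℕ.+ toℕ i) (ℕ.+-comm N (toℕ j)) (ℕ.+-monoʳ-< N j<i)))
  k≡ : offset i j ≡ toℕ j ℕ.+ (N ℕ.∸ toℕ i)
  k≡ = ℕ.m<n⇒m%n≡m small
  k+i : offset i j ℕ.+ toℕ i ≡ toℕ j ℕ.+ N
  k+i = trans (cong (ℕ._+ toℕ i) k≡) j+[N∸i]+i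

distance<N : ∀ {N} (i j : Fin N) → distance i j ℕ.< N
distance<N i j = ℕ.≤-<-trans (ℕ.∣m-n∣≤m⊔n (toℕ i) (toℕ j)) (ℕ.⊔-lub (toℕ<n i) (toℕ<n j))

unit-offset : ∀ {N} (i j : Fin N) → unit (offset i j) ≡ identity N i j
unit-offset {N} i j with i ≟ j
... | yes refl = cong unit (trans
  (cong (λ n → (n ℕ.% N) {{nonZeroIndex i}}) (ℕ.m+[n∸m]≡n (ℕ.<⇒≤ (toℕ<n i))))
  (ℕ.n%n≡0 N {{nonZeroIndex i}}))
... | no  i≢j  = unit-zero (offset≢0 (offset-cases i j))
  where
  unit-zero : ∀ {k} → k ≢ 0 → unit k ≡ 0ℚ
  unit-zero {zero}  k≢0 = contradiction refl k≢0
  unit-zero {suc _} _   = refl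
  offset≢0 : _ → offset i j ≢ 0
  offset≢0 (inj₁ (k≡d , _)) k≡0 = i≢j (toℕ-injective (ℕ.∣m-n∣≡0⇒m≡n (trans (sym k≡d) k≡0)))
  offset≢0 (inj₂ (k≡N∸d , _)) k≡0 = ℕ.m>n⇒m∸n≢0 (distance<N i j) (trans (sym k≡N∸d) k≡0)

-- For even N the sign is a character of ℤ/N, so its circulant matrix is the rank-one matrix s s′.
sign-offset : ∀ {N} → sign N ≡ 1ℚ → (i j : Fin N) → sign (offset i j) ≡ sign (toℕ i) * sign (toℕ j)
sign-offset {N} even i j = begin
  sign k                               ≡⟨ *-identityʳ (sign k) ⟨
  sign k * 1ℚ                          ≡⟨ cong (sign k *_) (sign² (toℕ i)) ⟨
  sign k * (s * s)                     ≡⟨ solve 2 (λ k s → k :* (s :* s) := s :* (k :* s)) refl (sign k) s ⟩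
  s * (sign k * s)                     ≡⟨ cong (s *_) (sign-+ k (toℕ i)) ⟨
  s * sign (k ℕ.+ toℕ i)               ≡⟨ cong (s *_) (congruent (offset-cases i j)) ⟩
  s * sign (toℕ j)                     ∎
  where
  open ≡-Reasoning
  k = offset i j
  s = sign (toℕ i)
  congruent : _ → sign (k ℕ.+ toℕ i) ≡ sign (toℕ j)
  congruent (inj₁ (_ , eq)) = cong sign eq
  congruent (inj₂ (_ , eq)) = begin
    sign (k ℕ.+ toℕ i)       ≡⟨ cong sign eq ⟩
    sign (toℕ j ℕ.+ N)       ≡⟨ sign-+ (toℕ j) N ⟩
    sign (toℕ j) * sign N    ≡⟨ cong (sign (toℕ j) *_) even ⟩
    sign (toℕ j) * 1ℚ        ≡⟨ *-identityʳ (sign (toℕ j)) ⟩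
    sign (toℕ j)             ∎

κ-offset : ∀ {N} (i j : Fin N) → κ ⌞ N ⌟ ⌞ offset i j ⌟ ≡ κ ⌞ N ⌟ ⌞ distance i j ⌟
κ-offset {N} i j with offset-cases i j
... | inj₁ (k≡d , _)   = cong (λ k → κ ⌞ N ⌟ ⌞ k ⌟) k≡d
... | inj₂ (k≡N∸d , _) = trans (cong (κ ⌞ N ⌟) (trans (cong ⌞_⌟ k≡N∸d) (ι-∸ (ℕ.<⇒≤ (distance<N i j)))))
  (κ-reflect ⌞ N ⌟ ⌞ distance i j ⌟)

-- Reciprocals and scaling factors.

reciprocal : ∀ N .{{_ : ℕ.NonZero N}} → ℚ
reciprocal N = + 1 / N

⅙ : ℚ
⅙ = + 1 / 6

1/6N : ∀ N .{{_ : ℕ.NonZero N}} .{{_ : ℕ.NonZero (6 ℕ.* N)}} → + 1 / (6 ℕ.* N) ≡ reciprocal N * ⅙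
1/6N N = begin
  q                            ≡⟨ solve 1 (λ q → q := q :* con 1ℚ) refl q ⟩
  q * 1ℚ                       ≡⟨ cong (q *_) (1/*ι≡1 N) ⟨
  q * (r * ⌞ N ⌟)              ≡⟨ solve 3 (λ q r N → q :* (r :* N) := q :* (con six :* N) :* (r :* con ⅙)) refl q r ⌞ N ⌟ ⟩
  q * (six * ⌞ N ⌟) * (r * ⅙)  ≡⟨ cong (λ t → q * t * (r * ⅙)) ι-6N ⟨
  q * ⌞ 6 ℕ.* N ⌟ * (r * ⅙)    ≡⟨ cong (_* (r * ⅙)) (1/*ι≡1 (6 ℕ.* N)) ⟩
  1ℚ * (r * ⅙)                 ≡⟨ *-identityˡ (r * ⅙) ⟩
  r * ⅙                        ∎
  where
  open ≡-Reasoning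
  q = + 1 / (6 ℕ.* N)
  r = reciprocal N
  ι-6N : ⌞ 6 ℕ.* N ⌟ ≡ six * ⌞ N ⌟
  ι-6N = trans (cong ι (ℤ.pos-* 6 N)) (trans (ι-homo-* (+ 6) (+ N)) (cong (_* ⌞ N ⌟) (ι≡/1 (+ 6))))

½*ι : ∀ N → + N / 2 ≡ ⌞ N ⌟ * ½
½*ι N = /≡ι*1/ (+ N) 2

-- Sums over finite index types, and nonnegativity.

∑-*ˡ : ∀ n c f → ∑ n (λ i → c * f i) ≡ c * ∑ n f
∑-*ˡ zero    c f = sym (*-zeroʳ c)
∑-*ˡ (suc n) c f = trans (cong (_+ c * f n) (∑-*ˡ n c f)) (sym (*-distribˡ-+ c (∑ n f) (f n)))

∑-head : ∀ n f → ∑ (suc n) f ≡ f 0 + ∑ n (f ∘ suc)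
∑-head zero    f = +-comm 0ℚ (f 0)
∑-head (suc n) f = trans (cong (_+ f (suc n)) (∑-head n f)) (+-assoc (f 0) (∑ n (f ∘ suc)) (f (suc n)))

sum≡∑ : ∀ {n} {f : Vector ℚ n} {h : ℕ → ℚ} → (∀ i → f i ≡ h (toℕ i)) → sum f ≡ ∑ n h
sum≡∑ {zero}      _  = refl
sum≡∑ {suc n} {h = h} eq = trans (cong₂ _+_ (eq zero) (sum≡∑ (eq ∘ suc))) (sym (∑-head n h))

sum-↑ : ∀ m {n} (f : Vector ℚ (m ℕ.+ n)) → sum f ≡ sum (f ∘ (_↑ˡ n)) + sum (f ∘ (m ↑ʳ_))
sum-↑ zero    f = sym (+-identityˡ (sum f))
sum-↑ (suc m) {n} f = trans (cong (λ p → f zero + p) (sum-↑ m (f ∘ suc)))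
  (sym (+-assoc (f zero) (sum (f ∘ suc ∘ (_↑ˡ n))) (sum (f ∘ suc ∘ (m ↑ʳ_)))))

sum-identity : ∀ {n} (i : Fin n) (f : Vector ℚ n) → sum (λ j → identity n i j * f j) ≡ f i
sum-identity {suc n} zero f = begin
  1ℚ * f zero + sum (λ j → 0ℚ * f (suc j))
    ≡⟨ cong₂ _+_ (*-identityˡ (f zero)) (sum-cong-≗ (λ j → *-zeroˡ (f (suc j)))) ⟩
  f zero + sum {n} (λ _ → 0ℚ)       ≡⟨ cong (λ p → f zero + p) (sum-replicate-zero n) ⟩
  f zero + 0ℚ                       ≡⟨ +-identityʳ (f zero) ⟩
  f zero                            ∎
  where open ≡-Reasoning
sum-identity (suc i) f = trans (cong₂ _+_ (*-zeroˡ (f zero)) (sum-identity i (f ∘ suc))) (+-identityˡ (f (suc i)))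

identity-sym : ∀ {n} (i j : Fin n) → identity n i j ≡ identity n j i
identity-sym i j with i ≟ j | j ≟ i
... | yes _   | yes _   = refl
... | no  _   | no  _   = refl
... | yes i≡j | no  j≢i = contradiction (sym i≡j) j≢i
... | no  i≢j | yes j≡i = contradiction (sym j≡i) i≢j

-- Turns a vector into a sequence, so that `sum≡∑` can move its sums to initial segments of ℕ. The
-- zeros past the end are a default.
extend : ∀ {n} → Vector ℚ n → ℕ → ℚ
extend {zero}  f _       = 0ℚ
extend {suc n} f zero    = f zero
extend {suc n} f (suc k) = extend (f ∘ suc) k

extend-toℕ : ∀ {n} (f : Vector ℚ n) i → f i ≡ extend f (toℕ i)
extend-toℕ f zero    = refl
extend-toℕ f (suc i) = extend-toℕ (f ∘ suc) i

0≤ι : ∀ n → 0ℚ ℚ.≤ ⌞ n ⌟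
0≤ι zero    = ≤-reflexive (sym (ι≡/1 (+ 0)))
0≤ι (suc n) = subst (0ℚ ℚ.≤_) (sym (⌞⌟-suc n)) (+-mono-≤ (0≤ι n) (nonNegative⁻¹ 1ℚ))

*-nonNeg : ∀ {p q} → 0ℚ ℚ.≤ p → 0ℚ ℚ.≤ q → 0ℚ ℚ.≤ p * q
*-nonNeg {p} {q} 0≤p 0≤q = nonNegative⁻¹ (p * q) {{nonNeg*nonNeg⇒nonNeg p {{nonNegative 0≤p}} q {{nonNegative 0≤q}}}}

-- The quadratic form of L

module Form (m : ℕ) .{{nz : ℕ.NonZero (m ℕ.* 2)}} where
  N : ℕ
  N = m ℕ.* 2

  ν r : ℚ
  ν = ⌞ N ⌟
  r = reciprocal N

  rν≡1 : r * ν ≡ 1ℚ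
  rν≡1 = 1/*ι≡1 N

  even : sign N ≡ 1ℚ
  even = sign-double m

  kernelA kernelB : ℕ → ℕ → ℚ
  kernelA i j = r * ⅙ * (sign i * sign j) * (κ ν ⌞ ℕ.∣ i - j ∣ ⌟ - six)
  kernelB i j = r * (sign i * sign j)

  Circ-x : ∀ i j → Circ (x (suc N)) i j ≡ identity N i j + kernelA (toℕ i) (toℕ j)
  Circ-x i j = begin
    Circ (x (suc N)) i j
      ≡⟨ cong (λ k → (xNumerator (suc N) k / (6 ℕ.* N)) {{nz6}}) (toℕ-mod i j) ⟩
    (xNumerator (suc N) k / (6 ℕ.* N)) {{nz6}}
      ≡⟨ /≡ι*1/ (xNumerator (suc N) k) (6 ℕ.* N) {{nz6}} ⟩
    ι (xNumerator (suc N) k) * (+ 1 / (6 ℕ.* N)) {{nz6}}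
      ≡⟨ cong₂ _*_ (ι-xNumerator m k (ℕ.<⇒≤ (ℕ.m%n<n _ N {{nonZeroIndex i}}))) (1/6N N {{nz}} {{nz6}}) ⟩
    (six * ν * unit k + sign k * (κ ν ⌞ k ⌟ - six)) * (r * ⅙)
      ≡⟨ cong₂ (λ s t → (six * ν * unit k + s * (t - six)) * (r * ⅙)) (sign-offset even i j) (κ-offset i j) ⟩
    (six * ν * unit k + s * (K - six)) * (r * ⅙)
      ≡⟨ solve 5 (λ ν r u s K → (con six :* ν :* u :+ s :* (K :- con six)) :* (r :* con ⅙)
           := r :* ν :* u :+ r :* con ⅙ :* s :* (K :- con six)) refl ν r (unit k) s K ⟩
    r * ν * unit k + kernelA (toℕ i) (toℕ j)
      ≡⟨ cong₂ (λ e u → e * u + kernelA (toℕ i) (toℕ j)) rν≡1 (unit-offset i j) ⟩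
    1ℚ * identity N i j + kernelA (toℕ i) (toℕ j)
      ≡⟨ cong (_+ kernelA (toℕ i) (toℕ j)) (*-identityˡ (identity N i j)) ⟩
    identity N i j + kernelA (toℕ i) (toℕ j) ∎
    where
    open ≡-Reasoning
    k : ℕ
    k = offset i j
    s K : ℚ
    s = sign (toℕ i) * sign (toℕ j)
    K = κ ν ⌞ distance i j ⌟
    nz6 : ℕ.NonZero (6 ℕ.* N)
    nz6 = ℕ.m*n≢0 6 N {{_}} {{nonZeroIndex i}}

  Circ-y : ∀ i j → Circ (y (suc N)) i j ≡ kernelB (toℕ i) (toℕ j) - identity N i j
  Circ-y i j = begin
    Circ (y (suc N)) i j
      ≡⟨ cong (λ k → yNumerator (suc N) k / N) (toℕ-mod i j) ⟩
    yNumerator (suc N) k / N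
      ≡⟨ /≡ι*1/ (yNumerator (suc N) k) N ⟩
    ι (yNumerator (suc N) k) * r
      ≡⟨ cong (_* r) (ι-yNumerator N k) ⟩
    (sign k - ν * unit k) * r
      ≡⟨ solve 4 (λ s ν u r → (s :- ν :* u) :* r := r :* s :- r :* ν :* u) refl (sign k) ν (unit k) r ⟩
    r * sign k - r * ν * unit k
      ≡⟨ cong₂ _-_ (cong (r *_) (sign-offset even i j)) (cong₂ _*_ rν≡1 (unit-offset i j)) ⟩
    kernelB (toℕ i) (toℕ j) - 1ℚ * identity N i j
      ≡⟨ cong (λ p → kernelB (toℕ i) (toℕ j) - p) (*-identityˡ (identity N i j)) ⟩
    kernelB (toℕ i) (toℕ j) - identity N i j ∎
    where
    open ≡-Reasoning
    k : ℕ
    k = offset i j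

  -- The blocks of L and its symmetry.

  data Index : Fin (1 ℕ.+ (N ℕ.+ N)) → Set where
    origin : Index zero
    upper  : ∀ i → Index (suc (i ↑ˡ N))
    lower  : ∀ i → Index (suc (N ↑ʳ i))

  index : ∀ i → Index i
  index zero = origin
  index (suc i) with splitAt N i | join-splitAt N N i
  ... | inj₁ j | refl = upper j
  ... | inj₂ j | refl = lower j

  -- The entries after substituting A = I + `kernelA` and B = `kernelB` - I. Matching on the view
  -- takes the place of the nested concatenations.
  entry : ∀ {i j} → Index i → Index j → ℚ
  entry origin    origin    = ν * ½
  entry origin    (upper _) = - ½
  entry origin    (lower _) = 0ℚ
  entry (upper _) origin    = - ½
  entry (upper i) (upper j) = identity N i j + kernelA (toℕ i) (toℕ j)
  entry (upper i) (lower j) = kernelB (toℕ i) (toℕ j) - identity N i j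
  entry (lower _) origin    = 0ℚ
  entry (lower i) (upper j) = kernelB (toℕ i) (toℕ j) - identity N i j
  entry (lower i) (lower j) = identity N i j

  middle bottom : Matrix ℚ N (1 ℕ.+ (N ℕ.+ N))
  middle = constant N 1 (- ½) ∥ Circ (x (suc N)) ∥ Circ (y (suc N))
  bottom = constant N 1 0ℚ ∥ Circ (y (suc N)) ∥ identity N

  L-entry : ∀ {i j} (a : Index i) (b : Index j) → L (suc N) i j ≡ entry a b
  L-entry origin    origin = ½*ι N
  L-entry origin    (upper j) = lookup-++ˡ (constant 1 N (- ½) zero) (constant 1 N 0ℚ zero) j
  L-entry origin    (lower j) = lookup-++ʳ (constant 1 N (- ½) zero) (constant 1 N 0ℚ zero) j
  L-entry {j = j} (upper i) b = trans (cong (λ row → row j) (lookup-++ˡ middle bottom i)) (middle-entry b)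
    where
    middle-entry : ∀ {j} (b : Index j) → middle i j ≡ entry (upper i) b
    middle-entry origin    = refl
    middle-entry (upper j) = trans (lookup-++ˡ (Circ (x (suc N)) i) (Circ (y (suc N)) i) j) (Circ-x i j)
    middle-entry (lower j) = trans (lookup-++ʳ (Circ (x (suc N)) i) (Circ (y (suc N)) i) j) (Circ-y i j)
  L-entry {j = j} (lower i) b = trans (cong (λ row → row j) (lookup-++ʳ middle bottom i)) (bottom-entry b)
    where
    bottom-entry : ∀ {j} (b : Index j) → bottom i j ≡ entry (lower i) b
    bottom-entry origin    = refl
    bottom-entry (upper j) = trans (lookup-++ˡ (Circ (y (suc N)) i) (identity N i) j) (Circ-y i j)
    bottom-entry (lower j) = lookup-++ʳ (Circ (y (suc N)) i) (identity N i) j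

  kernelA-sym : ∀ i j → kernelA i j ≡ kernelA j i
  kernelA-sym i j = cong₂ (λ s d → r * ⅙ * s * (κ ν ⌞ d ⌟ - six)) (*-comm (sign i) (sign j)) (ℕ.∣-∣-comm i j)

  kernelB-sym : ∀ i j → kernelB i j ≡ kernelB j i
  kernelB-sym i j = cong (r *_) (*-comm (sign i) (sign j))

  entry-sym : ∀ {i j} (a : Index i) (b : Index j) → entry a b ≡ entry b a
  entry-sym origin    origin    = refl
  entry-sym origin    (upper _) = refl
  entry-sym origin    (lower _) = refl
  entry-sym (upper _) origin    = refl
  entry-sym (upper i) (upper j) = cong₂ _+_ (identity-sym i j) (kernelA-sym (toℕ i) (toℕ j))
  entry-sym (upper i) (lower j) = cong₂ _-_ (kernelB-sym (toℕ i) (toℕ j)) (identity-sym i j)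
  entry-sym (lower _) origin    = refl
  entry-sym (lower i) (upper j) = cong₂ _-_ (kernelB-sym (toℕ i) (toℕ j)) (identity-sym i j)
  entry-sym (lower i) (lower j) = identity-sym i j

  L-sym : ∀ i j → L (suc N) i j ≡ L (suc N) j i
  L-sym i j = trans (L-entry (index i) (index j))
    (trans (entry-sym (index i) (index j)) (sym (L-entry (index j) (index i))))

  sum-blocks : (f : Vector ℚ (1 ℕ.+ (N ℕ.+ N))) →
    sum f ≡ f zero + (sum (λ i → f (suc (i ↑ˡ N))) + sum (λ i → f (suc (N ↑ʳ i))))
  sum-blocks f = cong (λ p → f zero + p) (sum-↑ N (f ∘ suc))

  -- The sum of squares at a rational vector.

  module _ (z : Vector ℚ (1 ℕ.+ (N ℕ.+ N))) where
    t : ℚ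
    t = z zero

    u v w : ℕ → ℚ
    u = extend λ i → z (suc (i ↑ˡ N))
    v = extend λ i → z (suc (N ↑ʳ i))
    w i = sign i * u i

    open PartialSums w using (W; kernel; row; centred; energy-decomposition)

    P R S Z : ℚ
    P = W N
    R = ∑ N λ i → sign i * v i
    S = ∑ N u
    Z = ∑ N λ k → centred N (suc k) * centred N (suc k)

    u≡ : ∀ i → z (suc (i ↑ˡ N)) ≡ u (toℕ i)
    u≡ = extend-toℕ λ i → z (suc (i ↑ˡ N))

    v≡ : ∀ i → z (suc (N ↑ʳ i)) ≡ v (toℕ i)
    v≡ = extend-toℕ λ i → z (suc (N ↑ʳ i))

    sum-identity+ : ∀ i (k f : Vector ℚ N) → sum (λ j → (identity N i j + k j) * f j) ≡ f i + sum (λ j → k j * f j)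
    sum-identity+ i k f = begin
      sum (λ j → (identity N i j + k j) * f j)
        ≡⟨ sum-cong-≗ (λ j → *-distribʳ-+ (f j) (identity N i j) (k j)) ⟩
      sum (λ j → identity N i j * f j + k j * f j)
        ≡⟨ ∑-distrib-+ (λ j → identity N i j * f j) (λ j → k j * f j) ⟩
      sum (λ j → identity N i j * f j) + sum (λ j → k j * f j)
        ≡⟨ cong (_+ sum (λ j → k j * f j)) (sum-identity i f) ⟩
      f i + sum (λ j → k j * f j) ∎
      where open ≡-Reasoning

    sum-minusIdentity : ∀ i (k f : Vector ℚ N) → sum (λ j → (k j - identity N i j) * f j) ≡ sum (λ j → k j * f j) - f i
    sum-minusIdentity i k f = begin
      sum (λ j → (k j - identity N i j) * f j)
        ≡⟨ sum-cong-≗ (λ j → solve 3 (λ k δ f → (k :- δ) :* f := k :* f :+ δ :* (:- f)) refl (k j) (identity N i j) (f j)) ⟩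
      sum (λ j → k j * f j + identity N i j * - f j)
        ≡⟨ ∑-distrib-+ (λ j → k j * f j) (λ j → identity N i j * - f j) ⟩
      sum (λ j → k j * f j) + sum (λ j → identity N i j * - f j)
        ≡⟨ cong (λ p → sum (λ j → k j * f j) + p) (sum-identity i (λ j → - f j)) ⟩
      sum (λ j → k j * f j) - f i ∎
      where open ≡-Reasoning

    -- The factor (-1)ʲ of the kernel turns uⱼ into wⱼ, and the constant -6 contributes a multiple
    -- of the partial sum of w.
    ∑-kernelA : ∀ i n → ∑ n (λ j → kernelA i j * u j) ≡ r * ⅙ * sign i * (∑ n (λ j → w j * kernel ν i j) - six * W n)
    ∑-kernelA i zero    = solve 2 (λ r s → con 0ℚ := r :* con ⅙ :* s :* (con 0ℚ :- con six :* con 0ℚ)) refl r (sign i)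
    ∑-kernelA i (suc n) = trans (cong (_+ kernelA i n * u n) (∑-kernelA i n))
      (solve 7 (λ r s s′ u K D W → r :* con ⅙ :* s :* (D :- con six :* W) :+ r :* con ⅙ :* (s :* s′) :* (K :- con six) :* u
        := r :* con ⅙ :* s :* (D :+ s′ :* u :* K :- con six :* (W :+ s′ :* u)))
       refl r (sign i) (sign n) (u n) (kernel ν i n) (∑ n (λ j → w j * kernel ν i j)) (W n))

    ∑-kernelB : ∀ i (f : ℕ → ℚ) n → ∑ n (λ j → kernelB i j * f j) ≡ r * sign i * ∑ n (λ j → sign j * f j)
    ∑-kernelB i f n = trans
      (∑-cong n λ j _ → solve 4 (λ r s s′ f → r :* (s :* s′) :* f := r :* s :* (s′ :* f)) refl r (sign i) (sign j) (f j))
      (∑-*ˡ n (r * sign i) (λ j → sign j * f j))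

    -- The components of L z in the second and third blocks. The term 0 * t is kept to match
    -- `product-entry` literally.
    upperRow lowerRow : ℕ → ℚ
    upperRow i = - ½ * t + ((u i + r * ⅙ * sign i * (row ν N i - six * P)) + (r * sign i * R - v i))
    lowerRow i = 0ℚ * t + ((r * sign i * P - u i) + v i)

    product : Vector ℚ (1 ℕ.+ (N ℕ.+ N))
    product i = sum λ j → L (suc N) i j * z j

    product-entry : ∀ {i} (a : Index i) → product i ≡
      entry a origin * t + (sum (λ j → entry a (upper j) * z (suc (j ↑ˡ N)))
                           + sum (λ j → entry a (lower j) * z (suc (N ↑ʳ j))))
    product-entry {i} a = trans (sum-blocks λ j → L (suc N) i j * z j)
      (cong₂ _+_ (cong (_* t) (L-entry a origin))
        (cong₂ _+_ (sum-cong-≗ λ j → cong (_* z (suc (j ↑ˡ N))) (L-entry a (upper j)))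
                   (sum-cong-≗ λ j → cong (_* z (suc (N ↑ʳ j))) (L-entry a (lower j)))))

    product-origin : product zero ≡ ν * ½ * t + (- ½ * S + 0ℚ * ∑ N v)
    product-origin = trans (product-entry origin) (cong (λ p → ν * ½ * t + p) (cong₂ _+_
      (trans (sum≡∑ (λ j → cong (- ½ *_) (u≡ j))) (∑-*ˡ N (- ½) u))
      (trans (sum≡∑ (λ j → cong (0ℚ *_) (v≡ j))) (∑-*ˡ N 0ℚ v))))

    product-upper : ∀ i → product (suc (i ↑ˡ N)) ≡ upperRow (toℕ i)
    product-upper i = trans (product-entry (upper i)) (cong (λ p → - ½ * t + p) (cong₂ _+_
      (trans (sum-identity+ i (λ j → kernelA (toℕ i) (toℕ j)) (λ j → z (suc (j ↑ˡ N))))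
        (cong₂ _+_ (u≡ i) (trans (sum≡∑ (λ j → cong (kernelA (toℕ i) (toℕ j) *_) (u≡ j))) (∑-kernelA (toℕ i) N))))
      (trans (sum-minusIdentity i (λ j → kernelB (toℕ i) (toℕ j)) (λ j → z (suc (N ↑ʳ j))))
        (cong₂ _-_ (trans (sum≡∑ (λ j → cong (kernelB (toℕ i) (toℕ j) *_) (v≡ j))) (∑-kernelB (toℕ i) v N)) (v≡ i)))))

    product-lower : ∀ i → product (suc (N ↑ʳ i)) ≡ lowerRow (toℕ i)
    product-lower i = trans (product-entry (lower i)) (cong (λ p → 0ℚ * t + p) (cong₂ _+_
      (trans (sum-minusIdentity i (λ j → kernelB (toℕ i) (toℕ j)) (λ j → z (suc (j ↑ˡ N))))
        (cong₂ _-_ (trans (sum≡∑ (λ j → cong (kernelB (toℕ i) (toℕ j) *_) (u≡ j))) (∑-kernelB (toℕ i) u N)) (u≡ i)))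
      (trans (sum-identity i (λ j → z (suc (N ↑ʳ j)))) (v≡ i))))

    form-blocks : sum (λ i → z i * product i) ≡
      t * (ν * ½ * t + (- ½ * S + 0ℚ * ∑ N v)) + (∑ N (λ i → u i * upperRow i) + ∑ N (λ i → v i * lowerRow i))
    form-blocks = trans (sum-blocks λ i → z i * product i) (cong₂ _+_ (cong (t *_) product-origin)
      (cong₂ _+_ (sum≡∑ λ i → cong₂ _*_ (u≡ i) (product-upper i)) (sum≡∑ λ i → cong₂ _*_ (v≡ i) (product-lower i))))

    -- The vector v + B u: since the last diagonal block of L is I, its squared norm accounts for
    -- every term in v.
    q : ℕ → ℚ
    q i = v i - u i + r * P * sign i

    -- The totals `P` and `R` stay fixed while n grows, so the identity holds increment by
    -- increment. At n = N the last three terms add up to r P² - N r² P², which vanishes because r N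
    -- = 1.
    completeSquares : ∀ n → ∑ n (λ i → u i * upperRow i) + ∑ n (λ i → v i * lowerRow i) ≡
      ∑ n (λ i → q i * q i) - ½ * t * ∑ n u + r * ⅙ * ∑ n (λ i → w i * row ν N i)
        + r * (P + R) * W n - r * P * ∑ n (λ i → sign i * v i) - ⌞ n ⌟ * (r * r * P * P)
    completeSquares zero = trans
      (solve 4 (λ t r P R → con 0ℚ :+ con 0ℚ := con 0ℚ :- con ½ :* t :* con 0ℚ :+ r :* con ⅙ :* con 0ℚ
          :+ r :* (P :+ R) :* con 0ℚ :- r :* P :* con 0ℚ :- con 0ℚ :* (r :* r :* P :* P)) refl t r P R)
      (cong (λ n → 0ℚ - ½ * t * 0ℚ + r * ⅙ * 0ℚ + r * (P + R) * 0ℚ - r * P * 0ℚ - n * (r * r * P * P)) (sym (ι≡/1 (+ 0))))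
    completeSquares (suc n) = begin
      (∑u + u n * upperRow n) + (∑v + v n * lowerRow n)
        ≡⟨ solve 4 (λ a b c d → (a :+ b) :+ (c :+ d) := (a :+ c) :+ (b :+ d))
             refl ∑u (u n * upperRow n) ∑v (v n * lowerRow n) ⟩
      (∑u + ∑v) + (u n * upperRow n + v n * lowerRow n)
        ≡⟨ cong₂ _+_ (completeSquares n)
             (solve 8 (λ t u v r s K P R →
               u :* (:- con ½ :* t :+ ((u :+ r :* con ⅙ :* s :* (K :- con six :* P)) :+ (r :* s :* R :- v)))
                 :+ v :* (con 0ℚ :* t :+ ((r :* s :* P :- u) :+ v))
               := let q = v :- u :+ r :* P :* s in
                  q :* q :- con ½ :* t :* u :+ r :* con ⅙ :* (s :* u :* K)
                    :+ r :* (P :+ R) :* (s :* u) :- r :* P :* (s :* v) :- s :* s :* (r :* r :* P :* P))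
              refl t (u n) (v n) r (sign n) (row ν N n) P R) ⟩
      _ ≡⟨ cong (λ e → B + (q n * q n - ½ * t * u n + r * ⅙ * (w n * row ν N n)
             + r * (P + R) * w n - r * P * (sign n * v n) - e * (r * r * P * P))) (sign² n) ⟩
      B + (q n * q n - ½ * t * u n + r * ⅙ * (w n * row ν N n)
             + r * (P + R) * w n - r * P * (sign n * v n) - 1ℚ * (r * r * P * P))
        ≡⟨ solve 15 (λ Q U X W V n q² u x w v t r P R →
             let c = r :* r :* P :* P in
             (Q :- con ½ :* t :* U :+ r :* con ⅙ :* X :+ r :* (P :+ R) :* W :- r :* P :* V :- n :* c)
               :+ (q² :- con ½ :* t :* u :+ r :* con ⅙ :* x :+ r :* (P :+ R) :* w :- r :* P :* v :- con 1ℚ :* c)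
             := (Q :+ q²) :- con ½ :* t :* (U :+ u) :+ r :* con ⅙ :* (X :+ x)
               :+ r :* (P :+ R) :* (W :+ w) :- r :* P :* (V :+ v) :- (n :+ con 1ℚ) :* c)
           refl (∑ n (λ i → q i * q i)) (∑ n u) (∑ n (λ i → w i * row ν N i)) (W n) (∑ n (λ i → sign i * v i)) ⌞ n ⌟
             (q n * q n) (u n) (w n * row ν N n) (w n) (sign n * v n) t r P R ⟩
      target (⌞ n ⌟ + 1ℚ)
        ≡⟨ cong target (⌞⌟-suc n) ⟨
      target ⌞ suc n ⌟ ∎
      where
      open ≡-Reasoning
      ∑u ∑v B : ℚ
      ∑u = ∑ n (λ i → u i * upperRow i)
      ∑v = ∑ n (λ i → v i * lowerRow i)
      B = ∑ n (λ i → q i * q i) - ½ * t * ∑ n u + r * ⅙ * ∑ n (λ i → w i * row ν N i)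
        + r * (P + R) * W n - r * P * ∑ n (λ i → sign i * v i) - ⌞ n ⌟ * (r * r * P * P)
      target : ℚ → ℚ
      target k = ∑ (suc n) (λ i → q i * q i) - ½ * t * ∑ (suc n) u + r * ⅙ * ∑ (suc n) (λ i → w i * row ν N i)
        + r * (P + R) * W (suc n) - r * P * ∑ (suc n) (λ i → sign i * v i) - k * (r * r * P * P)

    energy≡ : ν * ∑ N (λ i → w i * row ν N i) ≡ three * Z + three * ν * S * S
    energy≡ = trans (energy-decomposition N even) (cong (λ S → three * Z + three * ν * S * S) (∑-cong N λ i _ → sign*w i))
      where
      sign*w : ∀ i → sign i * w i ≡ u i
      sign*w i = trans (sym (*-assoc (sign i) (sign i) (u i))) (trans (cong (_* u i) (sign² i)) (*-identityˡ (u i)))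

    sumOfSquares : sum (λ i → z i * product i) ≡
      ∑ N (λ i → q i * q i) + ν * ½ * ((t - r * S) * (t - r * S)) + ½ * (r * r) * Z
    sumOfSquares = begin
      sum (λ i → z i * product i)
        ≡⟨ form-blocks ⟩
      t * (ν * ½ * t + (- ½ * S + 0ℚ * ∑ N v)) + (∑ N (λ i → u i * upperRow i) + ∑ N (λ i → v i * lowerRow i))
        ≡⟨ cong (λ p → t * (ν * ½ * t + (- ½ * S + 0ℚ * ∑ N v)) + p) (completeSquares N) ⟩
      _ ≡⟨ solve 9 (λ t ν r S T Q K P R →
             t :* (ν :* con ½ :* t :+ (:- con ½ :* S :+ con 0ℚ :* T)) :+
               (Q :- con ½ :* t :* S :+ r :* con ⅙ :* K :+ r :* (P :+ R) :* P :- r :* P :* R :- ν :* (r :* r :* P :* P))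
             := Q :+ ν :* con ½ :* t :* t :- t :* S :+ r :* con ⅙ :* K :+ (con 1ℚ :- r :* ν) :* (r :* P :* P))
           refl t ν r S (∑ N v) Q K P R ⟩
      Q + ν * ½ * t * t - t * S + r * ⅙ * K + (1ℚ - r * ν) * (r * P * P)
        ≡⟨ cong (λ e → Q + ν * ½ * t * t - t * S + r * ⅙ * K + (1ℚ - e) * (r * P * P)) rν≡1 ⟩
      Q + ν * ½ * t * t - t * S + r * ⅙ * K + (1ℚ - 1ℚ) * (r * P * P)
        ≡⟨ solve 7 (λ t ν r S Q K P →
             Q :+ ν :* con ½ :* t :* t :- t :* S :+ r :* con ⅙ :* K :+ (con 1ℚ :- con 1ℚ) :* (r :* P :* P)
             := Q :+ ν :* con ½ :* t :* t :- con 1ℚ :* (t :* S :- r :* con ⅙ :* K))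
           refl t ν r S Q K P ⟩
      Q + ν * ½ * t * t - 1ℚ * (t * S - r * ⅙ * K)
        -- Reading 1 as r N turns - t S into the cross term of (N/2)(t - r S)² and gives K the
        -- factor N required by `energy≡`.
        ≡⟨ cong (λ e → Q + ν * ½ * t * t - e * (t * S - r * ⅙ * K)) rν≡1 ⟨
      Q + ν * ½ * t * t - r * ν * (t * S - r * ⅙ * K)
        ≡⟨ solve 6 (λ t ν r S Q K → Q :+ ν :* con ½ :* t :* t :- r :* ν :* (t :* S :- r :* con ⅙ :* K)
             := Q :+ ν :* con ½ :* t :* t :- r :* ν :* t :* S :+ r :* r :* con ⅙ :* (ν :* K))
           refl t ν r S Q K ⟩
      Q + ν * ½ * t * t - r * ν * t * S + r * r * ⅙ * (ν * K)
        ≡⟨ cong (λ p → Q + ν * ½ * t * t - r * ν * t * S + r * r * ⅙ * p) energy≡ ⟩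
      Q + ν * ½ * t * t - r * ν * t * S + r * r * ⅙ * (three * Z + three * ν * S * S)
        -- The summand 3 N S² from `energy≡` supplies exactly the S² term that completes the square
        -- in t.
        ≡⟨ solve 6 (λ t ν r S Q Z →
             Q :+ ν :* con ½ :* t :* t :- r :* ν :* t :* S :+ r :* r :* con ⅙ :* (con three :* Z :+ con three :* ν :* S :* S)
             := Q :+ ν :* con ½ :* ((t :- r :* S) :* (t :- r :* S)) :+ con ½ :* (r :* r) :* Z)
           refl t ν r S Q Z ⟩
      Q + ν * ½ * ((t - r * S) * (t - r * S)) + ½ * (r * r) * Z ∎
      where
      open ≡-Reasoning
      Q K : ℚ
      Q = ∑ N (λ i → q i * q i)
      K = ∑ N (λ i → w i * row ν N i)

    form-nonNeg : 0ℚ ℚ.≤ sum (λ i → z i * product i)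
    form-nonNeg = subst (0ℚ ℚ.≤_) (sym sumOfSquares)
      (+-mono-≤ (+-mono-≤ (∑-nonNeg N λ i → square-nonNeg (q i))
                          (*-nonNeg (*-nonNeg (0≤ι N) (nonNegative⁻¹ ½)) (square-nonNeg (t - r * S))))
                (*-nonNeg (*-nonNeg (nonNegative⁻¹ ½) (square-nonNeg r))
                          (∑-nonNeg N λ k → square-nonNeg (centred N (suc k)))))

-- From rational vectors to Cauchy sequences.

seq-sum : ∀ {n} (f : Vector ℝ n) k → seq (Defs.sum f) k ≡ sum (λ i → seq (f i) k)
seq-sum {zero}  f k = refl
seq-sum {suc n} f k = cong (λ p → seq (f zero) k + p) (seq-sum (f ∘ suc) k)

-- Real operations act termwise and the entries of M are constant sequences, so the k-th term of the
-- real form is the rational form at the k-th terms of z. It is nonnegative for every k, and the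
-- threshold 0 works for every ε.
toReal-PSD : ∀ {n} (M : Matrix ℚ n n) → (∀ i j → M i j ≡ M j i) →
  (∀ z → 0ℚ ℚ.≤ sum (λ i → z i * sum (λ j → M i j * z j))) → PositiveSemidefinite (toReal M)
toReal-PSD M M-sym M-nonNeg = symmetric , nonNegative-form
  where
  symmetric : ∀ i j → toReal M i j ≃ᵣ toReal M j i
  symmetric i j ε 0<ε = 0 , λ _ _ → subst (λ p → ∣ p ∣ < ε)
    (sym (trans (cong (λ p → p - M j i) (M-sym i j)) (+-inverseʳ (M j i)))) 0<ε
  nonNegative-form : ∀ z → 0ᵣ ≤ᵣ dot z (toReal M *ᵥ z)
  nonNegative-form z ε 0<ε = 0 , λ k _ → subst (λ p → 0ℚ < p + ε) (sym (form k))
    (+-mono-≤-< (M-nonNeg (λ i → seq (z i) k)) 0<ε)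
    where
    form : ∀ k → seq (dot z (toReal M *ᵥ z)) k ≡ sum (λ i → seq (z i) k * sum (λ j → M i j * seq (z j) k))
    form k = trans (seq-sum (λ i → z i *ᵣ (toReal M *ᵥ z) i) k)
      (sum-cong-≗ λ i → cong (seq (z i) k *_) (seq-sum (λ j → toReal M i j *ᵣ z j) k))

-- Reduction to n = 2m + 1.

odd-form : ∀ n → 2 ∤ n → n ≡ suc (n ℕ./ 2 ℕ.* 2)
odd-form n 2∤n with n ℕ.% 2 | ℕ.m≡m%n+[m/n]*n n 2 | ℕ.m%n<n n 2
... | 0 | n≡ | _ = contradiction (divides (n ℕ./ 2) n≡) 2∤n
... | 1 | n≡ | _ = n≡
... | suc (suc _) | _ | ℕ.s≤s (ℕ.s≤s ())

theorem4p21 : ∀ (n : ℕ) → 5 ≤ n → 2 ∤ n → PositiveSemidefinite (toReal (L n))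
theorem4p21 n 5≤n 2∤n = subst (λ n → PositiveSemidefinite (toReal (L n))) (sym n≡)
  (toReal-PSD (L (suc (m ℕ.* 2))) (L-sym m) (form-nonNeg m))
  where
  open Form
  m : ℕ
  m = n ℕ./ 2
  n≡ : n ≡ suc (m ℕ.* 2)
  n≡ = odd-form n 2∤n
  instance
    nz : ℕ.NonZero (m ℕ.* 2)
    -- From 5 ≤ n = 2m + 1 follows 4 ≤ 2m, so N is positive and has a reciprocal.
    nz = ℕ.>-nonZero (ℕ.≤-trans (ℕ.s≤s ℕ.z≤n) (ℕ.s≤s⁻¹ (subst (5 ≤_) n≡ 5≤n)))
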